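{- For each integer $n\ge1$, \[ p(n)=p(2,3,0;n)+p(1,3,0;n) \] and \[ p_{2,4}(n)=p_{2,4}(3,4,0;n)+p_{2,4}(1,4,0;n). \]
   Context: $p(n)$ is the number of partitions of $n$; $p_{2,4}(n)$ is the number of partitions of $n$ with no part $\equiv2\pmod4$. Definition of $M(a,m,\nu;n)$ (integers $\nu\ge0$, $1\le a<m$, $n\ge0$): for a partition $\lambda_1\ge\dots\ge\lambda_k$ of $n$ into parts $\equiv a\pmod m$, put $\ell_i=(\lambda_i-a)/m+1$ (number of boxes of the row of $\lambda_i$ in the $m$-modular Young diagram), and let $t$ be the largest integer $0\le t\le k$ with $\ell_t\ge t+\nu+2$ (height of the $(\nu+2)$-Durfee rectangle, of width $t+\nu+2$). $M(a,m,\nu;n)$ counts partitions of $n$ into parts $\equiv a\pmod m$ in which each of $a,a+m,\dots,a+m\nu$ occurs at least once and $\ell_i<t+\nu+2$ for all $i>t$. Definitions: $p(a,m,\nu;n)$ is the number of partitions of $n$ such that, if $\beta$ is the sum of the parts $\not\equiv a\pmod m$, the parts $\equiv a\pmod m$ form a partition counted by $M(a,m,\nu;n-\beta)$. For $a\in\{1,3\}$, $p_{2,4}(a,4,\nu;n)$ counts partitions of $n$ into parts $\not\equiv2\pmod4$ such that, if $\alpha$ is the sum of the parts $\not\equiv a\pmod4$, the parts $\equiv a\pmod4$ form a partition counted by $M(a,4,\nu;n-\alpha)$. -}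

module Defs where

open import Data.Nat using (ℕ; zero; suc; _+_; _*_; _∸_; _≤_; _<_; _⊔_; _⊓_; NonZero; _≡ᵇ_; _≤ᵇ_; _<ᵇ_)
open import Data.Nat.DivMod using (_/_; _%_)
open import Data.Bool using (Bool; true; false; _∧_; not; if_then_else_)
open import Data.List using (List; []; _∷_; map; concatMap; filter; length; foldr; upTo; zip)
open import Data.Bool.ListAction using (any; all)
open import Data.List.Base using (applyUpTo)
open import Data.Product using (_×_; _,_; proj₁; proj₂)
open import Relation.Nullary.Decidable using (Dec; yes; no)
open import Data.Bool using (T)
open import Data.Bool.Properties using (T?)

-- Partitions of n are represented as non-increasing lists of positive
-- integers summing to n (λ₁ ≥ λ₂ ≥ … ≥ λ_k).

-- partsFuel f n k : all partitions of n with every part ≤ k,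
-- listed with non-increasing parts (fuel f ≥ n suffices).
partsFuel : ℕ → ℕ → ℕ → List (List ℕ)
partsFuel _ zero _ = [] ∷ []
partsFuel zero (suc _) _ = []
partsFuel (suc f) n@(suc _) k =
  concatMap (λ j → map (j ∷_) (partsFuel f (n ∸ j) j)) (applyUpTo suc (k ⊓ n))

partitions : ℕ → List (List ℕ)
partitions n = partsFuel n n n

countPartitions : (List ℕ → Bool) → ℕ → ℕ
countPartitions P n = length (filter (λ λs → T? (P λs)) (partitions n))

p : ℕ → ℕ
p = countPartitions (λ _ → true)

_≡_mod_ : ℕ → ℕ → (m : ℕ) → .{{NonZero m}} → Bool
x ≡ a mod m = (x % m) ≡ᵇ (a % m)

indexed : List ℕ → List (ℕ × ℕ)
indexed xs = zip (applyUpTo suc (length xs)) xs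

elem : ℕ → List ℕ → Bool
elem x xs = any (λ y → x ≡ᵇ y) xs

module _ (a m ν : ℕ) .{{_ : NonZero m}} where

  -- ℓ = (λ - a)/m + 1 : number of boxes in the m-modular diagram row
  ell : ℕ → ℕ
  ell x = (x ∸ a) / m + 1

  -- t : largest 0 ≤ t ≤ k with ℓ_t ≥ t + ν + 2  (t = 0 always allowed)
  durfeeT : List ℕ → ℕ
  durfeeT λs = foldr _⊔_ 0
    (map proj₁ (filter (λ ix → T? ((proj₁ ix + ν + 2) ≤ᵇ ell (proj₂ ix))) (indexed λs)))

  MProp : List ℕ → Bool
  MProp λs =
    all (λ x → x ≡ a mod m) λs
    ∧ all (λ j → elem (a + m * j) λs) (upTo (suc ν))
    ∧ all (λ ix → (durfeeT λs <ᵇ proj₁ ix) ⇒ (ell (proj₂ ix) <ᵇ durfeeT λs + ν + 2)) (indexed λs)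
    where
    _⇒_ : Bool → Bool → Bool
    false ⇒ _ = true
    true ⇒ b = b

  M : ℕ → ℕ
  M = countPartitions MProp

  partsCong : List ℕ → List ℕ
  partsCong λs = filter (λ x → T? (x ≡ a mod m)) λs

  pGen : ℕ → ℕ
  pGen = countPartitions (λ λs → MProp (partsCong λs))

no2mod4 : List ℕ → Bool
no2mod4 λs = all (λ x → not (x ≡ 2 mod 4)) λs

p24 : ℕ → ℕ
p24 = countPartitions no2mod4

p24Gen : ℕ → ℕ → ℕ → ℕ
p24Gen a ν = countPartitions (λ λs → no2mod4 λs ∧ MProp a 4 ν (partsCong a 4 ν λs))

{-# OPTIONS --safe #-}
module Submission where

-- Let a + b = m and write (x)_K = (1 - x)(1 - xq)…(1 - xq^(K-1)), with q, z standing for q^m, q^a.  Reading a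
-- partition from its largest row downwards until the Durfee rectangle is met shows that the series G_ν of
-- M(a, m, ν; ·) satisfies G_ν + G_(ν+1) = z^(ν+1) q^(ν(ν+1)/2) / (z)_∞, so that
-- G_0 = Σ_(k≥1) (-1)^(k-1) z^k q^(k(k-1)/2) / (z)_∞.  Adding the same formula for b (which is z ↦ q/z) and
-- restoring the parts ≡ 0, a, b (mod m) gives F · (1 - Σ_(k∈ℤ) (-1)^k z^k q^(k(k-1)/2)), where
-- F = 1 / ((q)_∞ (z)_∞ (q/z)_∞); by the Jacobi triple product this is F - 1.
-- Both claims are the cases (m, a, b) = (3, 2, 1) and (4, 3, 1).

open import Defs
open import Data.Nat using (ℕ; zero; suc; _+_; _*_; _∸_; _⊔_; _⊓_; _≤_; _<_; _≥_; z≤n; s≤s; NonZero; _≡ᵇ_; _≤ᵇ_; _<ᵇ_)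
import Data.Nat.Properties as ℕ
open import Data.Nat.DivMod using (_/_; _%_; m*n/n≡m; [m+kn]%n≡m%n)
open import Data.Nat.Tactic.RingSolver using () renaming (solve-∀ to solveℕ-∀)
open import Data.Integer using (ℤ; 0ℤ; 1ℤ) renaming (+_ to pos; _+_ to _+ᶻ_; -_ to -ᶻ_; _-_ to _-ᶻ_)
import Data.Integer.Properties as ℤ
open import Data.Integer.Tactic.RingSolver using (solve-∀)
open import Algebra.Properties.CommutativeSemigroup ℤ.+-commutativeSemigroup using (interchange)
open import Data.Bool using (Bool; true; false; _∧_; not; T; if_then_else_)
open import Data.Bool.Properties using (T?; T-≡; ∧-zeroʳ; ∧-identityʳ)
open import Data.Bool.ListAction using (all)
open import Data.List using (List; []; _∷_; _++_; _∷ʳ_; map; concatMap; filter; foldr; length; applyUpTo; zip)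
open import Data.List.Properties using (++-assoc; ++-identityʳ; concatMap-++; filter-++; filter-all; filter-none; length-++; applyUpTo-∷ʳ)
open import Data.List.Relation.Unary.All as All using (All; []; _∷_)
open import Data.List.Relation.Unary.All.Properties using (++⁺)
open import Data.Product using (Σ; _×_; _,_; proj₁; proj₂)
open import Data.Unit using (⊤; tt)
open import Data.Empty using (⊥-elim)
open import Function using (id; _∘_; const; flip; Equivalence)
open import Relation.Nullary using (yes; no; ¬_)
open import Relation.Binary.PropositionalEquality as ≡ using (_≡_; _≢_; refl; sym; cong; cong₂; subst; _≗_; module ≡-Reasoning)

-- Power series in q with integer coefficients

-- No product of two series is ever formed. A factor acts as an operator, a shift or `I s` for 1 /
-- (1 - q^s), and cancelling it is injectivity of `I s`. Infinite products are avoided as well: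
-- factors of high degree do not touch low coefficients, so finite products suffice and identities
-- are compared up to a degree n. Hence the triple product is first proved in a finite form, which
-- is accessible to induction on the sizes. The recurrence for G_ν is not derived from the
-- definition of M for ν > 0 either: only ν = 0 is matched with `MProp`, and larger ν appear through
-- the auxiliary series `V`.

Seq : Set
Seq = ℕ → ℤ

infixl 6 _⊕_ _⊖_

_⊕_ : Seq → Seq → Seq
(f ⊕ g) n = f n +ᶻ g n

neg : Seq → Seq
neg f n = -ᶻ f n

_⊖_ : Seq → Seq → Seq
f ⊖ g = f ⊕ neg g

⊖⇒⊕ : ∀ f g {h} → f ⊖ g ≗ h → f ≗ h ⊕ g
⊖⇒⊕ f g eq n = ≡.trans (restore (f n) (g n)) (cong (_+ᶻ g n) (eq n))
  where
  restore : ∀ x y → x ≡ (x -ᶻ y) +ᶻ y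
  restore = solve-∀

0̂ : Seq
0̂ _ = 0ℤ

-- Multiplication of the generating function by q ^ s.
sh : ℕ → Seq → Seq
sh zero    f n       = f n
sh (suc s) f zero    = 0ℤ
sh (suc s) f (suc n) = sh s f n

sh-local : ∀ s {f g} n → (∀ k → k ≤ n → f k ≡ g k) → sh s f n ≡ sh s g n
sh-local zero    n       h = h n ℕ.≤-refl
sh-local (suc s) zero    h = refl
sh-local (suc s) (suc n) h = sh-local s n (λ k k≤n → h k (ℕ.m≤n⇒m≤1+n k≤n))

sh-suc-local : ∀ s {f g} n → (∀ k → k < n → f k ≡ g k) → sh (suc s) f n ≡ sh (suc s) g n
sh-suc-local s zero    h = refl
sh-suc-local s (suc n) h = sh-local s n (λ k k≤n → h k (s≤s k≤n))

sh-cong : ∀ s {f g} → f ≗ g → sh s f ≗ sh s g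
sh-cong s h n = sh-local s n (λ k _ → h k)

sh-< : ∀ s f {n} → n < s → sh s f n ≡ 0ℤ
sh-< (suc s) f {zero}  _         = refl
sh-< (suc s) f {suc n} (s≤s n<s) = sh-< s f n<s

sh-≥ : ∀ s f {n} → s ≤ n → sh s f n ≡ f (n ∸ s)
sh-≥ zero    f _         = refl
sh-≥ (suc s) f (s≤s s≤n) = sh-≥ s f s≤n

sh-sh : ∀ s t f → sh s (sh t f) ≗ sh (s + t) f
sh-sh zero    t f n       = refl
sh-sh (suc s) t f zero    = refl
sh-sh (suc s) t f (suc n) = sh-sh s t f n

sh-comm : ∀ s t f → sh s (sh t f) ≗ sh t (sh s f)
sh-comm s t f n = begin
  sh s (sh t f) n    ≡⟨ sh-sh s t f n ⟩
  sh (s + t) f n   ≡⟨ cong (λ u → sh u f n) (ℕ.+-comm s t) ⟩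
  sh (t + s) f n   ≡⟨ sh-sh t s f n ⟨
  sh t (sh s f) n    ∎
  where open ≡-Reasoning

sh-⊕ : ∀ s f g → sh s (f ⊕ g) ≗ sh s f ⊕ sh s g
sh-⊕ zero    f g n       = refl
sh-⊕ (suc s) f g zero    = refl
sh-⊕ (suc s) f g (suc n) = sh-⊕ s f g n

sh-neg : ∀ s f → sh s (neg f) ≗ neg (sh s f)
sh-neg zero    f n       = refl
sh-neg (suc s) f zero    = refl
sh-neg (suc s) f (suc n) = sh-neg s f n

sh-0̂ : ∀ s → sh s 0̂ ≗ 0̂
sh-0̂ zero    n       = refl
sh-0̂ (suc s) zero    = refl
sh-0̂ (suc s) (suc n) = sh-0̂ s n

-- The laws of multiplication by a fixed series that the proof uses, in place of a Cauchy product.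
record Linear (Φ : Seq → Seq) : Set where
  field
    ⟦cong⟧ : ∀ {f g} → f ≗ g → Φ f ≗ Φ g
    ⟦⊕⟧    : ∀ f g → Φ (f ⊕ g) ≗ Φ f ⊕ Φ g
    ⟦neg⟧  : ∀ f → Φ (neg f) ≗ neg (Φ f)
    ⟦sh⟧   : ∀ s f → Φ (sh s f) ≗ sh s (Φ f)

  ⟦⊖⟧ : ∀ f g → Φ (f ⊖ g) ≗ Φ f ⊖ Φ g
  ⟦⊖⟧ f g n = ≡.trans (⟦⊕⟧ f (neg g) n) (cong (Φ f n +ᶻ_) (⟦neg⟧ g n))

  ⟦0̂⟧ : Φ 0̂ ≗ 0̂
  ⟦0̂⟧ n = begin
    Φ 0̂ n           ≡⟨ ⟦cong⟧ (λ _ → refl) n ⟩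
    Φ (0̂ ⊖ 0̂) n     ≡⟨ ⟦⊖⟧ 0̂ 0̂ n ⟩
    Φ 0̂ n -ᶻ Φ 0̂ n   ≡⟨ ℤ.+-inverseʳ (Φ 0̂ n) ⟩
    0ℤ              ∎
    where open ≡-Reasoning

open Linear

sh-linear : ∀ s → Linear (sh s)
sh-linear s = record { ⟦cong⟧ = sh-cong s ; ⟦⊕⟧ = sh-⊕ s ; ⟦neg⟧ = sh-neg s ; ⟦sh⟧ = sh-comm s }

neg-linear : Linear neg
neg-linear = record
  { ⟦cong⟧ = λ h n → cong -ᶻ_ (h n)
  ; ⟦⊕⟧    = λ f g n → ℤ.neg-distrib-+ (f n) (g n)
  ; ⟦neg⟧  = λ f n → refl
  ; ⟦sh⟧   = λ s f n → sym (sh-neg s f n) }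

id-linear : Linear id
id-linear = record { ⟦cong⟧ = id ; ⟦⊕⟧ = λ _ _ _ → refl ; ⟦neg⟧ = λ _ _ → refl ; ⟦sh⟧ = λ _ _ _ → refl }

∘-linear : ∀ {Φ Ψ} → Linear Φ → Linear Ψ → Linear (Φ ∘ Ψ)
∘-linear {Φ} {Ψ} φ ψ = record
  { ⟦cong⟧ = λ h → ⟦cong⟧ φ (⟦cong⟧ ψ h)
  ; ⟦⊕⟧    = λ f g n → ≡.trans (⟦cong⟧ φ (⟦⊕⟧ ψ f g) n) (⟦⊕⟧ φ (Ψ f) (Ψ g) n)
  ; ⟦neg⟧  = λ f n → ≡.trans (⟦cong⟧ φ (⟦neg⟧ ψ f) n) (⟦neg⟧ φ (Ψ f) n)
  ; ⟦sh⟧   = λ s f n → ≡.trans (⟦cong⟧ φ (⟦sh⟧ ψ s f) n) (⟦sh⟧ φ s (Ψ f) n) }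

-- Fixed-point equations for series

module _ {X : Set} (next : X → X) (F : X → Seq) (s : ℕ) where

  fixFuel : ℕ → X → Seq
  fixFuel zero    x n = 0ℤ
  fixFuel (suc k) x n = F x n +ᶻ sh (suc s) (fixFuel k (next x)) n

  fixFuel-irrelevant : ∀ k l x n → n < k → n < l → fixFuel k x n ≡ fixFuel l x n
  fixFuel-irrelevant (suc k) (suc l) x n (s≤s n≤k) (s≤s n≤l) =
    cong (F x n +ᶻ_) (sh-suc-local s n λ j j<n →
      fixFuel-irrelevant k l (next x) j (ℕ.<-≤-trans j<n n≤k) (ℕ.<-≤-trans j<n n≤l))

-- The solution of fix x = F x + q ^ s fix (next x); with the junk value F x for s = 0.
fix : ℕ → {X : Set} → (X → X) → (X → Seq) → X → Seq
fix zero    next F x n = F x n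
fix (suc s) next F x n = fixFuel next F s (suc n) x n

fix-unfold : ∀ s .{{_ : NonZero s}} {X : Set} (next : X → X) (F : X → Seq) x →
             fix s next F x ≗ F x ⊕ sh s (fix s next F (next x))
fix-unfold (suc s) next F x n = cong (F x n +ᶻ_) (sh-suc-local s n λ j j<n →
  fixFuel-irrelevant next F s n (suc j) (next x) j j<n ℕ.≤-refl)

-- A shifted term involves only lower degrees, so strong induction on the degree applies. Allowing
-- right-hand sides that agree only up to N yields uniqueness and truncated congruence at once.
fix-unique : ∀ s .{{_ : NonZero s}} {X : Set} (next : X → X) {F G g h : X → Seq} N →
             (∀ x n → n ≤ N → F x n ≡ G x n) →
             (∀ x → g x ≗ F x ⊕ sh s (g (next x))) →
             (∀ x → h x ≗ G x ⊕ sh s (h (next x))) →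
             ∀ x n → n ≤ N → g x n ≡ h x n
fix-unique (suc s) next {F} {G} {g} {h} N F≡G eg eh x n n≤N = go (suc n) x n ℕ.≤-refl n≤N
  where
  go : ∀ k x n → n < k → n ≤ N → g x n ≡ h x n
  go (suc k) x n (s≤s n≤k) n≤N = begin
    g x n                              ≡⟨ eg x n ⟩
    F x n +ᶻ sh (suc s) (g (next x)) n  ≡⟨ cong₂ _+ᶻ_ (F≡G x n n≤N) (sh-suc-local s n λ j j<n →
                                            go k (next x) j (ℕ.<-≤-trans j<n n≤k) (ℕ.≤-trans (ℕ.<⇒≤ j<n) n≤N)) ⟩
    G x n +ᶻ sh (suc s) (h (next x)) n  ≡⟨ eh x n ⟨
    h x n                              ∎
    where open ≡-Reasoning

fix-unique-≗ : ∀ s .{{_ : NonZero s}} {X : Set} (next : X → X) {F G g h : X → Seq} →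
               (∀ x → F x ≗ G x) →
               (∀ x → g x ≗ F x ⊕ sh s (g (next x))) →
               (∀ x → h x ≗ G x ⊕ sh s (h (next x))) →
               ∀ x → g x ≗ h x
fix-unique-≗ s next F≗G eg eh x n = fix-unique s next n (λ x k _ → F≗G x k) eg eh x n ℕ.≤-refl

-- Multiplication by 1 / (1 - q ^ s).
I : ℕ → Seq → Seq
I s f = fix s id (λ _ → f) tt

I-unfold : ∀ s .{{_ : NonZero s}} f → I s f ≗ f ⊕ sh s (I s f)
I-unfold s f = fix-unfold s id (λ _ → f) tt

I-unique : ∀ s .{{_ : NonZero s}} f g → g ≗ f ⊕ sh s g → g ≗ I s f
I-unique s f g eg = fix-unique-≗ s id {λ _ → f} {λ _ → f} {λ _ → g} {λ _ → I s f}
  (λ _ _ → refl) (λ _ → eg) (λ _ → I-unfold s f) tt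

I-local : ∀ s {f g} N → (∀ n → n ≤ N → f n ≡ g n) → ∀ n → n ≤ N → I s f n ≡ I s g n
I-local zero    N h = h
I-local (suc s) {f} {g} N h = fix-unique (suc s) id {g = λ _ → I (suc s) f} {h = λ _ → I (suc s) g} N
  (λ _ → h) (λ _ → I-unfold (suc s) f) (λ _ → I-unfold (suc s) g) tt

-- The junk value of `fix` makes `I 0` the identity, so no positivity is required and linearity
-- passes to `II` for any list. For s > 0 both sides of each law solve the same fixed-point
-- equation.
I-linear : ∀ s → Linear (I s)
I-linear zero = record { ⟦cong⟧ = id ; ⟦⊕⟧ = λ _ _ _ → refl ; ⟦neg⟧ = λ _ _ → refl ; ⟦sh⟧ = λ t f n → sh-cong t (λ _ → refl) n }
I-linear s@(suc _) = record
  { ⟦cong⟧ = λ h n → I-local s n (λ k _ → h k) n ℕ.≤-refl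
  ; ⟦⊕⟧    = λ f g n → sym (I-unique s (f ⊕ g) (I s f ⊕ I s g) (λ n → begin
      I s f n +ᶻ I s g n                                    ≡⟨ cong₂ _+ᶻ_ (I-unfold s f n) (I-unfold s g n) ⟩
      (f n +ᶻ sh s (I s f) n) +ᶻ (g n +ᶻ sh s (I s g) n)      ≡⟨ interchange (f n) _ _ _ ⟩
      (f n +ᶻ g n) +ᶻ (sh s (I s f) n +ᶻ sh s (I s g) n)      ≡⟨ cong ((f n +ᶻ g n) +ᶻ_) (sh-⊕ s (I s f) (I s g) n) ⟨
      (f n +ᶻ g n) +ᶻ sh s (I s f ⊕ I s g) n                 ∎) n)
  ; ⟦neg⟧  = λ f n → sym (I-unique s (neg f) (neg (I s f)) (λ n → begin
      -ᶻ I s f n                          ≡⟨ cong -ᶻ_ (I-unfold s f n) ⟩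
      -ᶻ (f n +ᶻ sh s (I s f) n)           ≡⟨ ℤ.neg-distrib-+ (f n) _ ⟩
      -ᶻ f n +ᶻ -ᶻ sh s (I s f) n           ≡⟨ cong (-ᶻ f n +ᶻ_) (sh-neg s (I s f) n) ⟨
      -ᶻ f n +ᶻ sh s (neg (I s f)) n       ∎) n)
  ; ⟦sh⟧   = λ t f n → sym (I-unique s (sh t f) (sh t (I s f)) (λ n → begin
      sh t (I s f) n                       ≡⟨ sh-cong t (I-unfold s f) n ⟩
      sh t (f ⊕ sh s (I s f)) n            ≡⟨ sh-⊕ t f _ n ⟩
      sh t f n +ᶻ sh t (sh s (I s f)) n     ≡⟨ cong (sh t f n +ᶻ_) (sh-comm t s (I s f) n) ⟩
      sh t f n +ᶻ sh s (sh t (I s f)) n     ∎) n) }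
  where
  open ≡-Reasoning

I-comm : ∀ s t f → I s (I t f) ≗ I t (I s f)
I-comm zero      t f = ⟦cong⟧ (I-linear t) (λ _ → refl)
I-comm s@(suc _) t f n = sym (I-unique s (I t f) (I t (I s f)) (λ n → begin
  I t (I s f) n                       ≡⟨ ⟦cong⟧ It (I-unfold s f) n ⟩
  I t (f ⊕ sh s (I s f)) n            ≡⟨ ⟦⊕⟧ It f _ n ⟩
  I t f n +ᶻ I t (sh s (I s f)) n      ≡⟨ cong (I t f n +ᶻ_) (⟦sh⟧ It s (I s f) n) ⟩
  I t f n +ᶻ sh s (I t (I s f)) n      ∎) n)
  where
  open ≡-Reasoning
  It = I-linear t

I-< : ∀ s f {n} → n < s → I s f n ≡ f n
I-< s@(suc _) f {n} n<s = begin
  I s f n                 ≡⟨ I-unfold s f n ⟩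
  f n +ᶻ sh s (I s f) n    ≡⟨ cong (f n +ᶻ_) (sh-< s (I s f) n<s) ⟩
  f n +ᶻ 0ℤ                ≡⟨ ℤ.+-identityʳ (f n) ⟩
  f n                     ∎
  where open ≡-Reasoning

I-⊖ : ∀ s .{{_ : NonZero s}} f → I s f ⊖ sh s (I s f) ≗ f
I-⊖ s f n = begin
  I s f n -ᶻ sh s (I s f) n                       ≡⟨ cong (_-ᶻ sh s (I s f) n) (I-unfold s f n) ⟩
  (f n +ᶻ sh s (I s f) n) -ᶻ sh s (I s f) n        ≡⟨ cancel (f n) _ ⟩
  f n                                            ∎
  where
  open ≡-Reasoning
  cancel : ∀ x y → (x +ᶻ y) -ᶻ y ≡ x
  cancel = solve-∀

-- Multiplying by 1 - q^s recovers f, and degrees up to N only need degrees up to N.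
I-injective : ∀ s .{{_ : NonZero s}} N {f g} → (∀ n → n ≤ N → I s f n ≡ I s g n) → ∀ n → n ≤ N → f n ≡ g n
I-injective s N {f} {g} h n n≤N = begin
  f n                        ≡⟨ I-⊖ s f n ⟨
  I s f n -ᶻ sh s (I s f) n   ≡⟨ cong₂ _-ᶻ_ (h n n≤N) (sh-local s n λ k k≤n → h k (ℕ.≤-trans k≤n n≤N)) ⟩
  I s g n -ᶻ sh s (I s g) n   ≡⟨ I-⊖ s g n ⟩
  g n                        ∎
  where open ≡-Reasoning

II : List ℕ → Seq → Seq
II L f = foldr I f L

II-linear : ∀ L → Linear (II L)
II-linear []      = id-linear
II-linear (s ∷ L) = ∘-linear (I-linear s) (II-linear L)

II-local : ∀ L {f g} N → (∀ n → n ≤ N → f n ≡ g n) → ∀ n → n ≤ N → II L f n ≡ II L g n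
II-local []      N h = h
II-local (s ∷ L) N h = I-local s N (II-local L N h)

II-I : ∀ L s f → II L (I s f) ≗ I s (II L f)
II-I []      s f n = refl
II-I (t ∷ L) s f n = ≡.trans (⟦cong⟧ (I-linear t) (II-I L s f) n) (I-comm t s (II L f) n)

II-comm : ∀ L L′ f → II L (II L′ f) ≗ II L′ (II L f)
II-comm L []       f n = refl
II-comm L (s ∷ L′) f n = ≡.trans (II-I L s (II L′ f) n) (⟦cong⟧ (I-linear s) (II-comm L L′ f) n)

δ : Bool → Seq
δ b zero    = if b then 1ℤ else 0ℤ
δ b (suc n) = 0ℤ

-- The generating function of the lists that satisfy P and are of the form s₁ … s₁ s₂ … s₂ …, where L = s₁ s₂ ….
E : List ℕ → (List ℕ → Bool) → Seq
E []      P = δ (P [])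
E (s ∷ L) P = fix s (λ Q l → Q (s ∷ l)) (E L) P

E-unfold : ∀ s .{{_ : NonZero s}} L P → E (s ∷ L) P ≗ E L P ⊕ sh s (E (s ∷ L) (P ∘ (s ∷_)))
E-unfold s L P = fix-unfold s (λ Q l → Q (s ∷ l)) (E L) P

-- Series of restricted partitions

E-cong : ∀ {R : ℕ → Set} {L P Q} → All R L → (∀ l → All R l → P l ≡ Q l) → E L P ≗ E L Q
E-cong {R} {[]}        []        P≡Q n = cong (λ b → δ b n) (P≡Q [] [])
E-cong {R} {zero ∷ L}  (r ∷ rs)  P≡Q n = E-cong rs P≡Q n
E-cong {R} {L@(suc s ∷ L′)} {P} {Q} (r ∷ rs) P≡Q = fix-unique-≗ (suc s) {X} next
  (λ (P , Q , P≡Q) → E-cong rs P≡Q)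
  (λ (P , _) → E-unfold (suc s) L′ P)
  (λ (_ , Q , _) → E-unfold (suc s) L′ Q)
  (P , Q , P≡Q)
  where
  -- The state carries both predicates and the proof that they agree, since prefixing a part changes
  -- all three.
  X = Σ (List ℕ → Bool) λ P → Σ (List ℕ → Bool) λ Q → ∀ l → All R l → P l ≡ Q l
  next : X → X
  next (P , Q , P≡Q) = P ∘ (suc s ∷_) , Q ∘ (suc s ∷_) , λ l rl → P≡Q (suc s ∷ l) (r ∷ rl)

E-cong-≗ : ∀ L {P Q} → P ≗ Q → E L P ≗ E L Q
E-cong-≗ L P≗Q = E-cong (All.universal (λ _ → tt) L) (λ l _ → P≗Q l)

E-true : ∀ L → E L (const true) ≗ II L (δ true)
E-true []          n = refl
E-true (zero ∷ L)  n = E-true L n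
E-true (suc s ∷ L) = fix-unique-≗ (suc s) {⊤} id {λ _ → E L (const true)} {λ _ → II L (δ true)}
  {λ _ → E (suc s ∷ L) (const true)} {λ _ → II (suc s ∷ L) (δ true)}
  (λ _ → E-true L) (λ _ → E-unfold (suc s) L (const true)) (λ _ → I-unfold (suc s) (II L (δ true))) tt

E-false : ∀ L → E L (const false) ≗ 0̂
E-false []          zero    = refl
E-false []          (suc n) = refl
E-false (zero ∷ L)  n = E-false L n
E-false (suc s ∷ L) = fix-unique-≗ (suc s) {⊤} id {λ _ → E L (const false)} {λ _ → 0̂}
  {λ _ → E (suc s ∷ L) (const false)} {λ _ → 0̂}
  (λ _ → E-false L) (λ _ → E-unfold (suc s) L (const false)) (λ _ n → sym (≡.trans (ℤ.+-identityˡ _) (sh-0̂ (suc s) n))) tt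

E-zero : ∀ L P → E L P 0 ≡ δ (P []) 0
E-zero []          P = refl
E-zero (zero ∷ L)  P = E-zero L P
E-zero (suc s ∷ L) P = ≡.trans (ℤ.+-identityʳ _) (E-zero L P)

module _ (ok cls : ℕ → Bool) where

  -- A relation and not a computed splitting, because later the parts contain a variable T and their
  -- residues come as equations.
  data Split : (L La Lo : List ℕ) → Set where
    []    : Split [] [] []
    inCls : ∀ {s L La Lo} .{{_ : NonZero s}} → ok s ≡ true → cls s ≡ true → Split L La Lo → Split (s ∷ L) (s ∷ La) Lo
    other : ∀ {s L La Lo} .{{_ : NonZero s}} → ok s ≡ true → cls s ≡ false → Split L La Lo → Split (s ∷ L) La (s ∷ Lo)
    notOk : ∀ {s L La Lo} .{{_ : NonZero s}} → ok s ≡ false → Split L La Lo → Split (s ∷ L) La Lo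

  onCls : (List ℕ → Bool) → List ℕ → Bool
  onCls P l = all ok l ∧ P (filter (λ x → T? (cls x)) l)

  -- An allowed part outside the class leaves the predicate unchanged, so its copies contribute a
  -- factor 1 / (1 - q^s); a forbidden part makes the predicate false. Only parts of the class
  -- change P, so there the fixed-point equation runs over all predicates.
  E-split : ∀ {L La Lo} → Split L La Lo → ∀ P → E L (onCls P) ≗ II Lo (E La P)
  E-split [] P n = refl
  E-split (inCls {s} {L} {La} {Lo} oks clss sp) = fix-unique-≗ s (λ P l → P (s ∷ l))
    {λ P → E L (onCls P)} {λ P → II Lo (E La P)} {λ P → E (s ∷ L) (onCls P)} {λ P → II Lo (E (s ∷ La) P)}
    (E-split sp)
    (λ P n → ≡.trans (E-unfold s L (onCls P) n)
      (cong (E L (onCls P) n +ᶻ_) (sh-cong s (E-cong-≗ (s ∷ L) (onCls-∷ P)) n)))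
    (λ P n → ≡.trans (⟦cong⟧ (II-linear Lo) (E-unfold s La P) n)
      (≡.trans (⟦⊕⟧ (II-linear Lo) (E La P) _ n) (cong (II Lo (E La P) n +ᶻ_) (⟦sh⟧ (II-linear Lo) s _ n))))
    where
    onCls-∷ : ∀ P l → onCls P (s ∷ l) ≡ onCls (P ∘ (s ∷_)) l
    onCls-∷ P l rewrite oks | clss = refl
  E-split (other {s} {L} {La} {Lo} oks clss sp) P = I-unique s (II Lo (E La P)) (E (s ∷ L) (onCls P)) λ n →
    ≡.trans (E-unfold s L (onCls P) n)
      (cong₂ _+ᶻ_ (E-split sp P n) (sh-cong s (E-cong-≗ (s ∷ L) onCls-∷) n))
    where
    onCls-∷ : ∀ l → onCls P (s ∷ l) ≡ onCls P l
    onCls-∷ l rewrite oks | clss = refl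
  E-split (notOk {s} {L} {La} {Lo} oks sp) P n = begin
    E (s ∷ L) (onCls P) n                                       ≡⟨ E-unfold s L (onCls P) n ⟩
    E L (onCls P) n +ᶻ sh s (E (s ∷ L) (onCls P ∘ (s ∷_))) n     ≡⟨ cong₂ _+ᶻ_ (E-split sp P n) (sh-cong s (E-cong-≗ (s ∷ L) onCls-∷) n) ⟩
    II Lo (E La P) n +ᶻ sh s (E (s ∷ L) (const false)) n         ≡⟨ cong (II Lo (E La P) n +ᶻ_) (sh-cong s (E-false (s ∷ L)) n) ⟩
    II Lo (E La P) n +ᶻ sh s 0̂ n                                 ≡⟨ cong (II Lo (E La P) n +ᶻ_) (sh-0̂ s n) ⟩
    II Lo (E La P) n +ᶻ 0ℤ                                       ≡⟨ ℤ.+-identityʳ _ ⟩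
    II Lo (E La P) n                                            ∎
    where
    open ≡-Reasoning
    onCls-∷ : ∀ l → onCls P (s ∷ l) ≡ false
    onCls-∷ l rewrite oks = refl

-- From lists of partitions to series

count : (List ℕ → Bool) → List (List ℕ) → ℕ
count P xs = length (filter (λ l → T? (P l)) xs)

count-++ : ∀ P xs ys → count P (xs ++ ys) ≡ count P xs + count P ys
count-++ P xs ys = ≡.trans (cong length (filter-++ (λ l → T? (P l)) xs ys)) (length-++ (filter (λ l → T? (P l)) xs))

count-map : ∀ P (g : List ℕ → List ℕ) xs → count P (map g xs) ≡ count (P ∘ g) xs
count-map P g []       = refl
count-map P g (x ∷ xs) with P (g x)
... | true  = cong suc (count-map P g xs)
... | false = count-map P g xs

down : ℕ → List ℕ
down zero    = []
down (suc k) = suc k ∷ down k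

-- The enumeration branches on the largest part, `E` on whether the largest admissible size occurs.
-- Splitting off the last block matches the two; when that size exceeds the number partitioned, the
-- block is missing and the shifted coefficient is 0.
count-parts : ∀ f n k P → n ≤ f → pos (count P (partsFuel f n k)) ≡ E (down k) P n
count-parts f zero k P _ = ≡.trans count-[[]] (sym (E-zero (down k) P))
  where
  count-[[]] : pos (count P ([] ∷ [])) ≡ δ (P []) 0
  count-[[]] with P []
  ... | true  = refl
  ... | false = refl
count-parts (suc f) (suc n) zero P _ = refl
count-parts (suc f) (suc n) (suc k) P (s≤s n≤f) with k ℕ.≤? n
... | yes k≤n = begin
  pos (count P (concatMap block (applyUpTo suc (suc (k ⊓ n)))))
    ≡⟨ cong (λ j → pos (count P (concatMap block (applyUpTo suc (suc j))))) (ℕ.m≤n⇒m⊓n≡m k≤n) ⟩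
  pos (count P (concatMap block (applyUpTo suc (suc k))))
    ≡⟨ cong (λ js → pos (count P (concatMap block js))) (applyUpTo-∷ʳ suc k) ⟨
  pos (count P (concatMap block (applyUpTo suc k ∷ʳ suc k)))
    ≡⟨ cong (λ xs → pos (count P xs)) (concatMap-++ block (applyUpTo suc k) (suc k ∷ [])) ⟩
  pos (count P (concatMap block (applyUpTo suc k) ++ block (suc k) ++ []))
    ≡⟨ cong (λ xs → pos (count P (concatMap block (applyUpTo suc k) ++ xs))) (++-identityʳ (block (suc k))) ⟩
  pos (count P (concatMap block (applyUpTo suc k) ++ block (suc k)))
    ≡⟨ cong pos (count-++ P (concatMap block (applyUpTo suc k)) (block (suc k))) ⟩
  pos (count P (concatMap block (applyUpTo suc k))) +ᶻ pos (count P (block (suc k)))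
    ≡⟨ cong₂ _+ᶻ_
         (cong (λ j → pos (count P (concatMap block (applyUpTo suc j)))) (sym (ℕ.m≤n⇒m⊓n≡m (ℕ.m≤n⇒m≤1+n k≤n))))
         (cong pos (count-map P (suc k ∷_) (partsFuel f (n ∸ k) (suc k)))) ⟩
  pos (count P (partsFuel (suc f) (suc n) k)) +ᶻ pos (count (P ∘ (suc k ∷_)) (partsFuel f (n ∸ k) (suc k)))
    ≡⟨ cong₂ _+ᶻ_ (count-parts (suc f) (suc n) k P (s≤s n≤f))
                 (count-parts f (n ∸ k) (suc k) (P ∘ (suc k ∷_)) (ℕ.≤-trans (ℕ.m∸n≤m n k) n≤f)) ⟩
  E (down k) P (suc n) +ᶻ E (down (suc k)) (P ∘ (suc k ∷_)) (n ∸ k)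
    ≡⟨ cong (E (down k) P (suc n) +ᶻ_) (sh-≥ (suc k) (E (down (suc k)) (P ∘ (suc k ∷_))) (s≤s k≤n)) ⟨
  E (down k) P (suc n) +ᶻ sh (suc k) (E (down (suc k)) (P ∘ (suc k ∷_))) (suc n)
    ≡⟨ E-unfold (suc k) (down k) P (suc n) ⟨
  E (down (suc k)) P (suc n) ∎
  where
  open ≡-Reasoning
  block : ℕ → List (List ℕ)
  block j = map (j ∷_) (partsFuel f (suc n ∸ j) j)
... | no k≰n = begin
  pos (count P (concatMap block (applyUpTo suc (suc (k ⊓ n)))))
    ≡⟨ cong (λ j → pos (count P (concatMap block (applyUpTo suc j))))
         (≡.trans (cong suc (ℕ.m≥n⇒m⊓n≡n (ℕ.<⇒≤ n<k))) (sym (ℕ.m≥n⇒m⊓n≡n n<k))) ⟩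
  pos (count P (partsFuel (suc f) (suc n) k))
    ≡⟨ count-parts (suc f) (suc n) k P (s≤s n≤f) ⟩
  E (down k) P (suc n)
    ≡⟨ ℤ.+-identityʳ _ ⟨
  E (down k) P (suc n) +ᶻ 0ℤ
    ≡⟨ cong (E (down k) P (suc n) +ᶻ_) (sh-< (suc k) (E (down (suc k)) (P ∘ (suc k ∷_))) (s≤s n<k)) ⟨
  E (down k) P (suc n) +ᶻ sh (suc k) (E (down (suc k)) (P ∘ (suc k ∷_))) (suc n)
    ≡⟨ E-unfold (suc k) (down k) P (suc n) ⟨
  E (down (suc k)) P (suc n) ∎
  where
  open ≡-Reasoning
  n<k = ℕ.≰⇒> k≰n
  block : ℕ → List (List ℕ)
  block j = map (j ∷_) (partsFuel f (suc n ∸ j) j)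

E-down-+ : ∀ j n P → E (down (j + n)) P n ≡ E (down n) P n
E-down-+ zero    n P = refl
E-down-+ (suc j) n P = begin
  E (down (suc j + n)) P n        ≡⟨ E-unfold (suc j + n) (down (j + n)) P n ⟩
  E (down (j + n)) P n +ᶻ sh (suc j + n) (E (down (suc j + n)) (P ∘ (suc (j + n) ∷_))) n
                                    ≡⟨ cong₂ _+ᶻ_ (E-down-+ j n P) (sh-< (suc j + n) (E (down (suc j + n)) (P ∘ (suc (j + n) ∷_))) (s≤s (ℕ.m≤n+m n j))) ⟩
  E (down n) P n +ᶻ 0ℤ               ≡⟨ ℤ.+-identityʳ _ ⟩
  E (down n) P n                    ∎
  where open ≡-Reasoning

-- The bound k stays free so that it can later be a multiple of m, a whole number of periods of
-- residues.
countPartitions-E : ∀ P {n k} → n ≤ k → pos (countPartitions P n) ≡ E (down k) P n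
countPartitions-E P {n} {k} n≤k = begin
  pos (countPartitions P n)             ≡⟨ count-parts n n n P ℕ.≤-refl ⟩
  E (down n) P n                        ≡⟨ E-down-+ (k ∸ n) n P ⟨
  E (down (k ∸ n + n)) P n            ≡⟨ cong (λ j → E (down j) P n) (ℕ.m∸n+n≡m n≤k) ⟩
  E (down k) P n                        ∎
  where open ≡-Reasoning

-- The series of M(a, m, 0; n)

T⇒≡true : ∀ {b} → T b → b ≡ true
T⇒≡true = Equivalence.to T-≡

¬T⇒≡false : ∀ {b} → ¬ T b → b ≡ false
¬T⇒≡false {false} _ = refl
¬T⇒≡false {true}  h = ⊥-elim (h tt)

all-true : ∀ {A : Set} {p : A → Bool} {xs} → All (λ x → p x ≡ true) xs → all p xs ≡ true
all-true []                      = refl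
all-true (_∷_ {xs = xs} px pxs) rewrite px = all-true pxs

all-cong : ∀ {A : Set} {p q : A → Bool} → p ≗ q → ∀ xs → all p xs ≡ all q xs
all-cong p≗q []       = refl
all-cong p≗q (x ∷ xs) = cong₂ _∧_ (p≗q x) (all-cong p≗q xs)

indexedFrom : ℕ → List ℕ → List (ℕ × ℕ)
indexedFrom o []       = []
indexedFrom o (x ∷ xs) = (suc o , x) ∷ indexedFrom (suc o) xs

indexed≡indexedFrom : ∀ xs → indexed xs ≡ indexedFrom 0 xs
indexed≡indexedFrom = go 0 suc λ _ → refl
  where
  go : ∀ o (f : ℕ → ℕ) → (∀ j → f j ≡ suc (o + j)) → ∀ xs →
       zip (applyUpTo f (length xs)) xs ≡ indexedFrom o xs
  go o f hf []       = refl
  go o f hf (x ∷ xs) = cong₂ _∷_ (cong (_, x) (≡.trans (hf 0) (cong suc (ℕ.+-identityʳ o))))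
    (go (suc o) (f ∘ suc) (λ j → ≡.trans (hf (suc j)) (cong suc (ℕ.+-suc o j))) xs)

indexedFrom-++ : ∀ o xs ys → indexedFrom o (xs ++ ys) ≡ indexedFrom o xs ++ indexedFrom (length xs + o) ys
indexedFrom-++ o []       ys = refl
indexedFrom-++ o (x ∷ xs) ys = cong ((suc o , x) ∷_)
  (≡.trans (indexedFrom-++ (suc o) xs ys)
    (cong (λ u → indexedFrom (suc o) xs ++ indexedFrom u ys) (ℕ.+-suc (length xs) o)))

indexed-++ : ∀ pre rest → indexed (pre ++ rest) ≡ indexedFrom 0 pre ++ indexedFrom (length pre) rest
indexed-++ pre rest = ≡.trans (indexed≡indexedFrom (pre ++ rest)) (≡.trans (indexedFrom-++ 0 pre rest)
  (cong (λ o → indexedFrom 0 pre ++ indexedFrom o rest) (ℕ.+-identityʳ (length pre))))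

-- The extra `⊔ o` covers the empty list, whose maximum is 0 and not o.
max-index : ∀ o xs → foldr _⊔_ 0 (map proj₁ (indexedFrom o xs)) ⊔ o ≡ length xs + o
max-index o []       = refl
max-index o (x ∷ xs) = begin
  (suc o ⊔ X) ⊔ o                  ≡⟨ cong (_⊔ o) (ℕ.⊔-comm (suc o) X) ⟩
  (X ⊔ suc o) ⊔ o                  ≡⟨ ℕ.⊔-assoc X (suc o) o ⟩
  X ⊔ (suc o ⊔ o)                  ≡⟨ cong (X ⊔_) (ℕ.m≥n⇒m⊔n≡m (ℕ.n≤1+n o)) ⟩
  X ⊔ suc o                        ≡⟨ max-index (suc o) xs ⟩
  length xs + suc o              ≡⟨ ℕ.+-suc (length xs) o ⟩
  suc (length xs + o)            ∎
  where
  open ≡-Reasoning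
  X = foldr _⊔_ 0 (map proj₁ (indexedFrom (suc o) xs))

All-indexedFrom : ∀ {R : ℕ → Set} {antiSum : ℕ × ℕ → Set} o {xs} →
                  (∀ {i x} → o < i → R x → antiSum (i , x)) → All R xs → All antiSum (indexedFrom o xs)
All-indexedFrom o h []         = []
All-indexedFrom o h (rx ∷ rxs) = h ℕ.≤-refl rx ∷ All-indexedFrom (suc o) (λ o<i → h (ℕ.<-trans ℕ.≤-refl o<i)) rxs

elem-++ : ∀ x xs ys → All (x ≢_) xs → elem x (xs ++ ys) ≡ elem x ys
elem-++ x []       ys []       = refl
elem-++ x (y ∷ xs) ys (x≢y ∷ h) rewrite ¬T⇒≡false (x≢y ∘ ℕ.≡ᵇ⇒≡ x y) = elem-++ x xs ys h

module Rows (m : ℕ) .{{_ : NonZero m}} where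

  -- The row has k + 1 boxes, which causes the shifts by one below. For c = m the rows are the
  -- positive multiples of m.
  row : ℕ → ℕ → ℕ
  row c k = c + k * m

  rows : ℕ → ℕ → List ℕ
  rows c zero    = []
  rows c (suc K) = row c K ∷ rows c K

  row-nonZero : ∀ c .{{_ : NonZero c}} k → NonZero (row c k)
  row-nonZero (suc c) k = _

  row-injective : ∀ c {k l} → row c k ≡ row c l → k ≡ l
  row-injective c {k} {l} eq = ℕ.*-cancelʳ-≡ k l m (ℕ.+-cancelˡ-≡ c _ _ eq)

  module Class (a : ℕ) .{{_ : NonZero a}} where

    IsRow : ℕ → ℕ → Set
    IsRow K x = Σ ℕ λ k → k < K × x ≡ row a k

    rows-IsRow : ∀ K → All (IsRow K) (rows a K)
    rows-IsRow zero    = []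
    rows-IsRow (suc K) = (K , ℕ.≤-refl , refl) ∷
      All.map (λ (k , k<K , eq) → k , ℕ.m≤n⇒m≤1+n k<K , eq) (rows-IsRow K)

    E-rows : ∀ K P → E (rows a (suc K)) P ≗ E (rows a K) P ⊕ sh (row a K) (E (rows a (suc K)) (P ∘ (row a K ∷_)))
    E-rows K P = E-unfold (row a K) {{row-nonZero a K}} (rows a K) P

    II-rows : ∀ K f → II (rows a (suc K)) f ≗ II (rows a K) f ⊕ sh (row a K) (II (rows a (suc K)) f)
    II-rows K f = I-unfold (row a K) {{row-nonZero a K}} (II (rows a K) f)

    c : ℕ → Seq
    c K = II (rows a K) (δ true)

    -- Deleting one copy of a turns the partitions containing a into all partitions with the same
    -- admissible rows.
    E-elem : ∀ K → E (rows a (suc K)) (elem a) ≗ sh a (c (suc K))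
    E-elem zero n = begin
      E (rows a 1) (elem a) n                                         ≡⟨ E-rows 0 (elem a) n ⟩
      δ false n +ᶻ sh (row a 0) (E (rows a 1) (elem a ∘ (row a 0 ∷_))) n
        ≡⟨ cong₂ _+ᶻ_ (E-false [] n) (sh-cong (row a 0) (λ k → ≡.trans (E-cong-≗ (rows a 1) hit k) (E-true (rows a 1) k)) n) ⟩
      0ℤ +ᶻ sh (row a 0) (c 1) n                                       ≡⟨ ℤ.+-identityˡ _ ⟩
      sh (row a 0) (c 1) n                                            ≡⟨ cong (λ s → sh s (c 1) n) (ℕ.+-identityʳ a) ⟩
      sh a (c 1) n                                                    ∎
      where
      open ≡-Reasoning
      hit : ∀ l → elem a (row a 0 ∷ l) ≡ true
      hit l rewrite T⇒≡true (ℕ.≡⇒≡ᵇ a (a + 0) (sym (ℕ.+-identityʳ a))) = refl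
    E-elem (suc K) = fix-unique-≗ s {{row-nonZero a (suc K)}} {⊤} id
      {λ _ → E (rows a (suc K)) (elem a)} {λ _ → sh a (c (suc K))}
      {λ _ → E (rows a (suc (suc K))) (elem a)} {λ _ → sh a (c (suc (suc K)))}
      (λ _ → E-elem K)
      (λ _ n → ≡.trans (E-rows (suc K) (elem a) n)
        (cong (E (rows a (suc K)) (elem a) n +ᶻ_) (sh-cong s (E-cong-≗ (rows a (suc (suc K))) miss) n)))
      (λ _ n → ≡.trans (sh-cong a (II-rows (suc K) (δ true)) n)
        (≡.trans (sh-⊕ a (c (suc K)) _ n) (cong (sh a (c (suc K)) n +ᶻ_) (sh-comm a s (c (suc (suc K))) n))))
      tt
      where
      s = row a (suc K)
      miss : ∀ l → elem a (s ∷ l) ≡ elem a l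
      miss l = elem-++ a (s ∷ []) l ((λ a≡s → ℕ.0≢1+n (row-injective a {0} {suc K} (≡.trans (ℕ.+-identityʳ a) a≡s))) ∷ [])

    -- V D j is the series of the partitions into rows of at most D + j + 2 boxes in which, for some t, the
    -- t largest rows have more than j + t + 1 boxes and all the others at most j + t + 1.
    V : ℕ → ℕ → Seq
    V zero    j = c (suc j)
    V (suc D) j = V D j ⊕ sh (row a (suc (suc (D + j)))) (V D (suc j))

    -- Combinatorially: in a partition whose (t + 1)-st row has exactly j + t + 2 boxes, move t boxes of that
    -- row to the t rows above it, one to each.
    V-step : ∀ D j → V D j ⊕ sh (row a (suc j)) (V D (suc j)) ≗ c (suc (suc (D + j)))
    V-step zero    j n = sym (II-rows (suc j) (δ true) n)
    V-step (suc D) j n = begin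
      (x +ᶻ sh A (V D (suc j)) n) +ᶻ sh B (V D (suc j) ⊕ sh A′ (V D (suc (suc j)))) n
        ≡⟨ cong ((x +ᶻ sh A (V D (suc j)) n) +ᶻ_) (sh-⊕ B (V D (suc j)) _ n) ⟩
      (x +ᶻ sh A (V D (suc j)) n) +ᶻ (sh B (V D (suc j)) n +ᶻ sh B (sh A′ (V D (suc (suc j)))) n)
        ≡⟨ cong (λ z → (x +ᶻ sh A (V D (suc j)) n) +ᶻ (sh B (V D (suc j)) n +ᶻ z)) swap-sh ⟩
      (x +ᶻ sh A (V D (suc j)) n) +ᶻ (sh B (V D (suc j)) n +ᶻ sh A (sh B′ (V D (suc (suc j)))) n)
        ≡⟨ interchange x (sh A (V D (suc j)) n) (sh B (V D (suc j)) n) _ ⟩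
      (x +ᶻ sh B (V D (suc j)) n) +ᶻ (sh A (V D (suc j)) n +ᶻ sh A (sh B′ (V D (suc (suc j)))) n)
        ≡⟨ cong₂ _+ᶻ_ (V-step D j n) (≡.sym (sh-⊕ A (V D (suc j)) _ n)) ⟩
      c (suc (suc (D + j))) n +ᶻ sh A (V D (suc j) ⊕ sh B′ (V D (suc (suc j)))) n
        ≡⟨ cong (c (suc (suc (D + j))) n +ᶻ_) (sh-cong A (V-step D (suc j)) n) ⟩
      c (suc (suc (D + j))) n +ᶻ sh A (c (suc (suc (D + suc j)))) n
        ≡⟨ cong (λ k → c (suc (suc (D + j))) n +ᶻ sh A (c (suc (suc k))) n) (ℕ.+-suc D j) ⟩
      c (suc (suc (D + j))) n +ᶻ sh A (c (suc (suc (suc (D + j))))) n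
        ≡⟨ II-rows (suc (suc (D + j))) (δ true) n ⟨
      c (suc (suc (suc (D + j)))) n ∎
      where
      open ≡-Reasoning
      x  = V D j n
      A  = row a (suc (suc (D + j)))
      A′ = row a (suc (suc (D + suc j)))
      B  = row a (suc j)
      B′ = row a (suc (suc j))
      -- One box moves from the row `A′` to the row `B`, which leaves `A` and `B′`.
      exponents : ∀ a D j m → (a + (1 + j) * m) + (a + (2 + (D + (1 + j))) * m)
                            ≡ (a + (2 + (D + j)) * m) + (a + (2 + j) * m)
      exponents = solveℕ-∀
      swap-sh : sh B (sh A′ (V D (suc (suc j)))) n ≡ sh A (sh B′ (V D (suc (suc j)))) n
      swap-sh = ≡.trans (sh-sh B A′ _ n) (≡.trans (cong (λ s → sh s (V D (suc (suc j))) n) (exponents a D j m))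
        (sym (sh-sh A B′ _ n)))

    private
      ℓ : ℕ → ℕ
      ℓ = ell a m 0

      M₀ : List ℕ → Bool
      M₀ = MProp a m 0

      durfee : List ℕ → ℕ
      durfee = durfeeT a m 0

    -- The auxiliary implication of MProp has no name in scope; unification recovers it for the
    -- underscore in the type of ⇒≡if.
    mutual
      MProp-if : ∀ l → M₀ l ≡ all (λ x → x ≡ a mod m) l ∧ (elem (a + m * 0) l ∧ true) ∧
                   all (λ ix → if durfee l <ᵇ proj₁ ix then ℓ (proj₂ ix) <ᵇ durfee l + 0 + 2 else true) (indexed l)
      MProp-if l = cong (λ b → all (λ x → x ≡ a mod m) l ∧ (elem (a + m * 0) l ∧ true) ∧ b) (all-cong (⇒≡if l) (indexed l))

      ⇒≡if : ∀ l ix → _ ≡ (if durfee l <ᵇ proj₁ ix then ℓ (proj₂ ix) <ᵇ durfee l + 0 + 2 else true)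
      ⇒≡if l ix with durfee l <ᵇ proj₁ ix
      ... | true  = refl
      ... | false = refl

    ℓ-row : ∀ k → ℓ (row a k) ≡ suc k
    ℓ-row k = begin
      (a + k * m ∸ a) / m + 1   ≡⟨ cong (λ u → u / m + 1) (ℕ.m+n∸m≡n a (k * m)) ⟩
      k * m / m + 1               ≡⟨ cong (_+ 1) (m*n/n≡m k m) ⟩
      k + 1                         ≡⟨ ℕ.+-comm k 1 ⟩
      suc k                           ∎
      where open ≡-Reasoning

    row-mod : ∀ k → (row a k ≡ a mod m) ≡ true
    row-mod k = T⇒≡true (ℕ.≡⇒≡ᵇ (row a k % m) (a % m) ([m+kn]%n≡m%n a k m))

    Tall : ℕ × ℕ → Set
    Tall ix = proj₁ ix + 0 + 2 ≤ ℓ (proj₂ ix)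

    durfee-++ : ∀ pre rest → All Tall (indexedFrom 0 pre) → All (¬_ ∘ Tall) (indexedFrom (length pre) rest) →
                durfee (pre ++ rest) ≡ length pre
    durfee-++ pre rest tall short = begin
      durfee (pre ++ rest)
        ≡⟨ cong (λ ixs → maxIndex (filter tall? ixs)) (indexed-++ pre rest) ⟩
      maxIndex (filter tall? (indexedFrom 0 pre ++ indexedFrom (length pre) rest))
        ≡⟨ cong maxIndex (filter-++ tall? (indexedFrom 0 pre) _) ⟩
      maxIndex (filter tall? (indexedFrom 0 pre) ++ filter tall? (indexedFrom (length pre) rest))
        ≡⟨ cong₂ (λ xs ys → maxIndex (xs ++ ys)) (filter-all tall? (All.map ℕ.≤⇒≤ᵇ tall))
             (filter-none tall? (All.map (λ h → h ∘ ℕ.≤ᵇ⇒≤ _ _) short)) ⟩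
      maxIndex (indexedFrom 0 pre ++ [])
        ≡⟨ cong maxIndex (++-identityʳ (indexedFrom 0 pre)) ⟩
      maxIndex (indexedFrom 0 pre)
        ≡⟨ ℕ.⊔-identityʳ _ ⟨
      maxIndex (indexedFrom 0 pre) ⊔ 0
        ≡⟨ max-index 0 pre ⟩
      length pre + 0
        ≡⟨ ℕ.+-identityʳ _ ⟩
      length pre ∎
      where
      open ≡-Reasoning
      tall? = λ (ix : ℕ × ℕ) → T? ((proj₁ ix + 0 + 2) ≤ᵇ ℓ (proj₂ ix))
      maxIndex : List (ℕ × ℕ) → ℕ
      maxIndex ixs = foldr _⊔_ 0 (map proj₁ ixs)

    AllRows : List ℕ → Set
    AllRows l = All (λ x → Σ ℕ λ k → x ≡ row a k) l

    all-row-mod : ∀ {l} → AllRows l → all (λ x → x ≡ a mod m) l ≡ true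
    all-row-mod rl = all-true (All.map (λ { (k , refl) → row-mod k }) rl)

    IsRow⇒AllRows : ∀ {K l} → All (IsRow K) l → AllRows l
    IsRow⇒AllRows = All.map (λ (k , _ , eq) → k , eq)

    IsRow⇒ℓ≤ : ∀ {K x} → IsRow K x → ℓ x ≤ K
    IsRow⇒ℓ≤ {K} (k , k<K , refl) = subst (_≤ K) (sym (ℓ-row k)) k<K

    tall-≢a : ∀ o pre → All Tall (indexedFrom o pre) → All (a ≢_) pre
    tall-≢a o []        []         = []
    tall-≢a o (x ∷ pre) (tx ∷ tpre) = (λ { refl → ℕ.<⇒≱ (s≤s (s≤s z≤n)) (ℕ.≤-trans (ℕ.m≤n+m 2 (suc o + 0)) (subst (suc o + 0 + 2 ≤_) ℓ-a tx)) })
      ∷ tall-≢a (suc o) pre tpre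
      where
      ℓ-a : ℓ a ≡ 1
      ℓ-a = ≡.trans (cong ℓ (sym (ℕ.+-identityʳ a))) (ℓ-row 0)

    not-tall : ∀ {K i x} → ℓ x ≤ K → K ≤ suc i → ¬ Tall (i , x)
    not-tall {K} {i} {x} ℓ≤K K≤1+i t = ℕ.<⇒≱ (ℕ.≤-refl {suc (suc i)})
      (ℕ.≤-trans (ℕ.≤-reflexive (sym i+0+2≡2+i)) (ℕ.≤-trans t (ℕ.≤-trans ℓ≤K K≤1+i)))
      where
      i+0+2≡2+i : i + 0 + 2 ≡ suc (suc i)
      i+0+2≡2+i = ≡.trans (cong (_+ 2) (ℕ.+-identityʳ i)) (ℕ.+-comm i 2)

    -- With i tall rows on top and at most i + 1 boxes in all others, the Durfee height is i and the
    -- strict bound i + 2 holds below it. Tall rows have at least three boxes, so the one-box row a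
    -- can only lie in `rest`.
    MProp-short : ∀ pre rest → AllRows pre → All Tall (indexedFrom 0 pre) → All (IsRow (suc (length pre))) rest →
                  M₀ (pre ++ rest) ≡ elem a rest
    MProp-short pre rest rowPre tall rowRest = begin
      M₀ (pre ++ rest)
        ≡⟨ MProp-if (pre ++ rest) ⟩
      all (λ x → x ≡ a mod m) (pre ++ rest) ∧ (elem (a + m * 0) (pre ++ rest) ∧ true) ∧ all cond (indexed (pre ++ rest))
        ≡⟨ cong₂ _∧_ (all-row-mod (++⁺ rowPre (IsRow⇒AllRows rowRest))) (cong₂ _∧_ elem≡ cond≡) ⟩
      elem a rest ∧ true
        ≡⟨ ∧-identityʳ _ ⟩
      elem a rest ∎
      where
      open ≡-Reasoning
      i = length pre
      d≡i : durfee (pre ++ rest) ≡ i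
      d≡i = durfee-++ pre rest tall (All-indexedFrom i (λ i<j r → not-tall (IsRow⇒ℓ≤ r) (s≤s (ℕ.<⇒≤ i<j))) rowRest)
      cond : ℕ × ℕ → Bool
      cond ix = if durfee (pre ++ rest) <ᵇ proj₁ ix then ℓ (proj₂ ix) <ᵇ durfee (pre ++ rest) + 0 + 2 else true
      elem≡ : elem (a + m * 0) (pre ++ rest) ∧ true ≡ elem a rest
      elem≡ = ≡.trans (∧-identityʳ _) (≡.trans
        (cong (λ x → elem x (pre ++ rest)) (≡.trans (cong (a +_) (ℕ.*-zeroʳ m)) (ℕ.+-identityʳ a)))
        (elem-++ a pre rest (tall-≢a 0 pre tall)))
      cond-rest : ∀ {j x} → IsRow (suc i) x → cond (j , x) ≡ true
      cond-rest {j} {x} r with durfee (pre ++ rest) <ᵇ j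
      ... | false = refl
      ... | true  = T⇒≡true (ℕ.<⇒<ᵇ (ℕ.≤-trans (s≤s (IsRow⇒ℓ≤ r))
        (ℕ.≤-reflexive (≡.trans (ℕ.+-comm 2 i) (cong (_+ 2) (≡.trans (sym d≡i) (sym (ℕ.+-identityʳ _))))))))
      cond-pre : ∀ {j x} → j ≤ i → cond (j , x) ≡ true
      cond-pre {j} j≤i rewrite ¬T⇒≡false {durfee (pre ++ rest) <ᵇ j}
        (λ t → ℕ.<⇒≱ (ℕ.<ᵇ⇒< (durfee (pre ++ rest)) j t) (subst (j ≤_) (sym d≡i) j≤i)) = refl
      index-≤ : ∀ o xs → All (λ ix → proj₁ ix ≤ length xs + o) (indexedFrom o xs)
      index-≤ o []       = []
      index-≤ o (x ∷ xs) = s≤s (ℕ.m≤n+m o (length xs)) ∷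
        All.map (λ h → ℕ.≤-trans h (ℕ.≤-reflexive (ℕ.+-suc (length xs) o))) (index-≤ (suc o) xs)
      cond≡ : all cond (indexed (pre ++ rest)) ≡ true
      cond≡ = ≡.trans (cong (all cond) (indexed-++ pre rest)) (all-true (++⁺
        (All.map (λ h → cond-pre (ℕ.≤-trans h (ℕ.≤-reflexive (ℕ.+-identityʳ i)))) (index-≤ 0 pre))
        (All-indexedFrom i (λ {j} _ → cond-rest {j}) rowRest)))

    -- A row of exactly i + 2 boxes in position i + 1 is too short to extend the Durfee rectangle,
    -- which needs i + 3, and too long to lie below it.
    MProp-critical : ∀ pre rest → AllRows pre → All Tall (indexedFrom 0 pre) → All (IsRow (suc (suc (length pre)))) rest →
                     M₀ (pre ++ row a (suc (length pre)) ∷ rest) ≡ false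
    MProp-critical pre rest rowPre tall rowRest = begin
      M₀ l
        ≡⟨ MProp-if l ⟩
      A ∧ B ∧ all cond (indexed l)
        ≡⟨ cong (λ b → A ∧ B ∧ b) cond≡ ⟩
      A ∧ B ∧ false
        ≡⟨ cong (A ∧_) (∧-zeroʳ B) ⟩
      A ∧ false
        ≡⟨ ∧-zeroʳ A ⟩
      false ∎
      where
      open ≡-Reasoning
      i = length pre
      x = row a (suc i)
      l = pre ++ x ∷ rest
      A = all (λ x → x ≡ a mod m) l
      B = elem (a + m * 0) l ∧ true
      d≡i : durfee l ≡ i
      d≡i = durfee-++ pre (x ∷ rest) tall (not-tall (ℕ.≤-reflexive (ℓ-row (suc i))) ℕ.≤-refl ∷
        All-indexedFrom (suc i) (λ 1+i<j r → not-tall (IsRow⇒ℓ≤ r) (s≤s (ℕ.<⇒≤ 1+i<j))) rowRest)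
      cond : ℕ × ℕ → Bool
      cond ix = if durfee l <ᵇ proj₁ ix then ℓ (proj₂ ix) <ᵇ durfee l + 0 + 2 else true
      cond-x : cond (suc i , x) ≡ false
      cond-x rewrite d≡i | ℓ-row (suc i) | T⇒≡true (ℕ.<⇒<ᵇ (ℕ.n<1+n i)) | ℕ.+-identityʳ i | ℕ.+-comm i 2 =
        ¬T⇒≡false (λ t → ℕ.<-irrefl refl (ℕ.<ᵇ⇒< i i t))
      all-++-false : ∀ xs {ys} → all cond ys ≡ false → all cond (xs ++ ys) ≡ false
      all-++-false []       h = h
      all-++-false (z ∷ xs) h = ≡.trans (cong (cond z ∧_) (all-++-false xs h)) (∧-zeroʳ (cond z))
      cond≡ : all cond (indexed l) ≡ false
      cond≡ = ≡.trans (cong (all cond) (indexed-++ pre (x ∷ rest)))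
        (all-++-false (indexedFrom 0 pre) (cong (_∧ all cond (indexedFrom (suc i) rest)) cond-x))

    -- The number i of tall rows already read takes the place of ν in `V`, as the t-th remaining row
    -- is tall when it has at least i + t + 2 boxes. While D > 0 the largest admissible row has at
    -- least i + 3 boxes and is tall if it occurs; at D = 0 it has i + 2 boxes and must not occur.
    E-MProp : ∀ D pre → AllRows pre → All Tall (indexedFrom 0 pre) →
              E (rows a (suc (suc (D + length pre)))) (λ l → M₀ (pre ++ l)) ≗ sh a (V D (length pre))
    E-MProp zero pre rowPre tall n = begin
      E (rows a (suc (suc i))) P n
        ≡⟨ E-rows (suc i) P n ⟩
      E (rows a (suc i)) P n +ᶻ sh x (E (rows a (suc (suc i))) (P ∘ (x ∷_))) n
        ≡⟨ cong₂ _+ᶻ_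
             (≡.trans (E-cong (rows-IsRow (suc i)) (λ l → MProp-short pre l rowPre tall) n) (E-elem i n))
             (sh-cong x (λ k → ≡.trans (E-cong (rows-IsRow (suc (suc i))) (λ l → MProp-critical pre l rowPre tall) k)
               (E-false (rows a (suc (suc i))) k)) n) ⟩
      sh a (c (suc i)) n +ᶻ sh x 0̂ n
        ≡⟨ cong (sh a (c (suc i)) n +ᶻ_) (sh-0̂ x n) ⟩
      sh a (c (suc i)) n +ᶻ 0ℤ
        ≡⟨ ℤ.+-identityʳ _ ⟩
      sh a (c (suc i)) n ∎
      where
      open ≡-Reasoning
      i = length pre
      x = row a (suc i)
      P = λ l → M₀ (pre ++ l)
    E-MProp (suc D) pre rowPre tall n = begin
      E (rows a (suc K)) P n
        ≡⟨ E-rows K P n ⟩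
      E (rows a K) P n +ᶻ sh x (E (rows a (suc K)) (P ∘ (x ∷_))) n
        ≡⟨ cong₂ _+ᶻ_ (E-MProp D pre rowPre tall n) (sh-cong x after-x n) ⟩
      sh a (V D i) n +ᶻ sh x (sh a (V D (suc i))) n
        ≡⟨ cong (sh a (V D i) n +ᶻ_) (sh-comm x a (V D (suc i)) n) ⟩
      sh a (V D i) n +ᶻ sh a (sh x (V D (suc i))) n
        ≡⟨ sh-⊕ a (V D i) (sh x (V D (suc i))) n ⟨
      sh a (V D i ⊕ sh x (V D (suc i))) n ∎
      where
      open ≡-Reasoning
      i = length pre
      K = suc (suc (D + i))
      x = row a K
      P = λ l → M₀ (pre ++ l)
      pre′ = pre ∷ʳ x
      len : length pre′ ≡ suc i
      len = ≡.trans (length-++ pre) (ℕ.+-comm i 1)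
      tall′ : All Tall (indexedFrom 0 pre′)
      tall′ = subst (All Tall) (sym (indexedFrom-++ 0 pre (x ∷ []))) (++⁺ tall (tall-x ∷ []))
        where
        lhs≡ : suc (i + 0) + 0 + 2 ≡ suc (suc (suc i))
        lhs≡ = ≡.trans (ℕ.+-comm _ 2) (cong (suc ∘ suc) (≡.trans (ℕ.+-identityʳ _) (cong suc (ℕ.+-identityʳ i))))
        tall-x : suc (i + 0) + 0 + 2 ≤ ℓ x
        tall-x = ≡.subst₂ _≤_ (sym lhs≡) (sym (ℓ-row K)) (s≤s (s≤s (s≤s (ℕ.m≤n+m i D))))
      after-x : E (rows a (suc K)) (P ∘ (x ∷_)) ≗ sh a (V D (suc i))
      after-x k = begin
        E (rows a (suc K)) (P ∘ (x ∷_)) k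
          ≡⟨ E-cong-≗ (rows a (suc K)) (λ l → cong M₀ (sym (++-assoc pre (x ∷ []) l))) k ⟩
        E (rows a (suc K)) (λ l → M₀ (pre′ ++ l)) k
          ≡⟨ cong (λ u → E (rows a (suc (suc u))) (λ l → M₀ (pre′ ++ l)) k)
               (sym (≡.trans (cong (D +_) len) (ℕ.+-suc D i))) ⟩
        E (rows a (suc (suc (D + length pre′)))) (λ l → M₀ (pre′ ++ l)) k
          ≡⟨ E-MProp D pre′ (++⁺ rowPre ((K , refl) ∷ [])) tall′ k ⟩
        sh a (V D (length pre′)) k
          ≡⟨ cong (λ u → sh a (V D u) k) len ⟩
        sh a (V D (suc i)) k ∎

-- The finite Jacobi triple product

linear-⊖sh : ∀ {Φ} → Linear Φ → ∀ s f → Φ f ⊖ sh s (Φ f) ≗ Φ (f ⊖ sh s f)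
linear-⊖sh {Φ} φ s f n = sym (≡.trans (⟦⊖⟧ φ f (sh s f) n) (cong (λ z → Φ f n -ᶻ z) (⟦sh⟧ φ s f n)))

sgn : ℕ → ℤ → ℤ
sgn zero    z = z
sgn (suc k) z = -ᶻ sgn k z

sg : ℕ → Seq → Seq
sg k f n = sgn k (f n)

sg-linear : ∀ k → Linear (sg k)
sg-linear zero    = id-linear
sg-linear (suc k) = ∘-linear neg-linear (sg-linear k)

-- Passing both indices avoids the subtraction i = M - j in exponents and in lengths of products.
antiSum : ℕ → (ℕ → ℕ → Seq) → Seq
antiSum zero    f = f 0 0
antiSum (suc M) f = f 0 (suc M) ⊕ antiSum M (λ j i → f (suc j) i)

antiSum-local : ∀ M {f g : ℕ → ℕ → Seq} {n} → (∀ j i → j + i ≡ M → f j i n ≡ g j i n) → antiSum M f n ≡ antiSum M g n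
antiSum-local zero    h = h 0 0 refl
antiSum-local (suc M) h = cong₂ _+ᶻ_ (h 0 (suc M) refl) (antiSum-local M (λ j i eq → h (suc j) i (cong suc eq)))

antiSum-⊕ : ∀ M f g → antiSum M (λ j i → f j i ⊕ g j i) ≗ antiSum M f ⊕ antiSum M g
antiSum-⊕ zero    f g n = refl
antiSum-⊕ (suc M) f g n = ≡.trans (cong ((f 0 (suc M) n +ᶻ g 0 (suc M) n) +ᶻ_) (antiSum-⊕ M (f ∘ suc) (g ∘ suc) n))
  (interchange (f 0 (suc M) n) _ _ _)

antiSum-linear : ∀ {Φ} → Linear Φ → ∀ M f → Φ (antiSum M f) ≗ antiSum M (λ j i → Φ (f j i))
antiSum-linear φ zero    f n = refl
antiSum-linear {Φ} φ (suc M) f n = ≡.trans (⟦⊕⟧ φ (f 0 (suc M)) (antiSum M (f ∘ suc)) n) (cong (Φ (f 0 (suc M)) n +ᶻ_) (antiSum-linear φ M (f ∘ suc) n))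

antiSum-last : ∀ M f → antiSum (suc M) f ≗ antiSum M (λ j i → f j (suc i)) ⊕ f (suc M) 0
antiSum-last zero    f n = refl
antiSum-last (suc M) f n = ≡.trans (cong (f 0 (suc (suc M)) n +ᶻ_) (antiSum-last M (f ∘ suc) n))
  (sym (ℤ.+-assoc (f 0 (suc (suc M)) n) _ _))

antiSum-flip : ∀ M f → antiSum M f ≗ antiSum M (flip f)
antiSum-flip zero    f n = refl
antiSum-flip (suc M) f n = ≡.trans (antiSum-last M f n) (≡.trans (ℤ.+-comm _ (f (suc M) 0 n))
  (cong (f (suc M) 0 n +ᶻ_) (antiSum-flip M (λ j i → f j (suc i)) n)))

alt : ℕ → (ℕ → ℤ) → ℤ
alt zero    h = 0ℤ
alt (suc J) h = h 0 -ᶻ alt J (h ∘ suc)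

alt-last : ∀ J h → alt (suc J) h ≡ alt J h +ᶻ sgn J (h J)
alt-last zero    h = ≡.trans (ℤ.+-identityʳ (h 0)) (sym (ℤ.+-identityˡ (h 0)))
alt-last (suc J) h = ≡.trans (cong (λ z → h 0 -ᶻ z) (alt-last J (h ∘ suc))) (regroup (h 0) _ _)
  where
  regroup : ∀ a b c → a -ᶻ (b +ᶻ c) ≡ (a -ᶻ b) +ᶻ -ᶻ c
  regroup = solve-∀

alt-cong : ∀ J {h h′} → h ≗ h′ → alt J h ≡ alt J h′
alt-cong zero    eq = refl
alt-cong (suc J) eq = cong₂ _-ᶻ_ (eq 0) (alt-cong J (eq ∘ suc))

alt-telescope : ∀ J (g h : ℕ → ℤ) → (∀ j → g j ≡ h j -ᶻ g (suc j)) → g J ≡ 0ℤ → g 0 ≡ alt J h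
alt-telescope zero    g h eq gJ≡0 = gJ≡0
alt-telescope (suc J) g h eq gJ≡0 = ≡.trans (eq 0) (cong (λ z → h 0 -ᶻ z) (alt-telescope J (g ∘ suc) (h ∘ suc) (eq ∘ suc) gJ≡0))

antiSum-alt : ∀ N (G : ℕ → Seq) n → antiSum N (λ j _ → sg j (G j)) n ≡ alt (suc N) (λ k → G k n)
antiSum-alt zero    G n = sym (ℤ.+-identityʳ (G 0 n))
antiSum-alt (suc N) G n = cong (G 0 n +ᶻ_) (≡.trans (sym (antiSum-linear neg-linear N (λ j _ → sg j (G (suc j))) n)) (cong -ᶻ_ (antiSum-alt N (G ∘ suc) n)))

module Triple (m : ℕ) .{{_ : NonZero m}} where
  open Rows m

  -- This is f / ((q)_i (q)_j), that is, the Gaussian binomial coefficient divided by (q)_(i+j); in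
  -- this normalisation only operators `I` occur.
  C : ℕ → ℕ → Seq → Seq
  C i j f = II (rows m i) (II (rows m j) f)

  C-linear : ∀ i j → Linear (C i j)
  C-linear i j = ∘-linear (II-linear (rows m i)) (II-linear (rows m j))

  C-comm : ∀ i j f → C i j f ≗ C j i f
  C-comm i j = II-comm (rows m i) (rows m j)

  private
    -- The value at 0 is the convention 1 / (q)_(-1) = 0, with which the Pascal rule also holds on
    -- the boundary.
    Cᵢ Cⱼ : ℕ → ℕ → Seq → Seq
    Cᵢ zero    j f = 0̂
    Cᵢ (suc i) j f = C i j f
    Cⱼ i zero    f = 0̂
    Cⱼ i (suc j) f = C i j f

  -- The q-Pascal rule [i+j, j] = [i+j-1, j] + q^i [i+j-1, j-1], divided by (q)_{i+j-1}.
  pascal : ∀ i j f → C i j f ⊖ sh ((i + j) * m) (C i j f) ≗ Cᵢ i j f ⊕ sh (i * m) (Cⱼ i j f)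
  pascal zero    zero    f n = ℤ.+-inverseʳ (f n)
  pascal zero    (suc j) f n = ≡.trans (I-⊖ (row m j) {{row-nonZero m j}} (II (rows m j) f) n) (sym (ℤ.+-identityˡ _))
  pascal (suc i) zero    f n = begin
    C (suc i) 0 f n -ᶻ sh ((suc i + 0) * m) (C (suc i) 0 f) n
      ≡⟨ cong (λ k → C (suc i) 0 f n -ᶻ sh (k * m) (C (suc i) 0 f) n) (ℕ.+-identityʳ (suc i)) ⟩
    C (suc i) 0 f n -ᶻ sh (row m i) (C (suc i) 0 f) n
      ≡⟨ I-⊖ (row m i) {{row-nonZero m i}} (C i 0 f) n ⟩
    C i 0 f n
      ≡⟨ ℤ.+-identityʳ _ ⟨
    C i 0 f n +ᶻ 0ℤ
      ≡⟨ cong (C i 0 f n +ᶻ_) (sh-0̂ (row m i) n) ⟨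
    C i 0 f n +ᶻ sh (row m i) 0̂ n ∎
    where open ≡-Reasoning
  -- This case is (1 - x) + x (1 - y) = 1 - x y with x = q^A and y = q^B.
  pascal (suc i) (suc j) f n = sym (begin
    C i (suc j) f n +ᶻ sh A (C (suc i) j f) n
      ≡⟨ cong₂ _+ᶻ_ (sym (I-⊖ A {{row-nonZero m i}} (C i (suc j) f) n)) (sh-cong A dropⱼ n) ⟩
    (X n -ᶻ sh A X n) +ᶻ sh A (X ⊖ sh B X) n
      ≡⟨ cong ((X n -ᶻ sh A X n) +ᶻ_) (⟦⊖⟧ (sh-linear A) X (sh B X) n) ⟩
    (X n -ᶻ sh A X n) +ᶻ (sh A X n -ᶻ sh A (sh B X) n)
      ≡⟨ cancel (X n) (sh A X n) _ ⟩
    X n -ᶻ sh A (sh B X) n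
      ≡⟨ cong (λ z → X n -ᶻ z) (sh-sh A B X n) ⟩
    X n -ᶻ sh (A + B) X n
      ≡⟨ cong (λ s → X n -ᶻ sh s X n) (sym (ℕ.*-distribʳ-+ m (suc i) (suc j))) ⟩
    X n -ᶻ sh ((suc i + suc j) * m) X n ∎)
    where
    open ≡-Reasoning
    A = row m i
    B = row m j
    X = C (suc i) (suc j) f
    dropⱼ : C (suc i) j f ≗ X ⊖ sh B X
    dropⱼ k = sym (≡.trans (linear-⊖sh (II-linear (rows m (suc i))) B (II (rows m (suc j)) f) k)
      (⟦cong⟧ (II-linear (rows m (suc i))) (I-⊖ B {{row-nonZero m j}} (II (rows m j) f)) k))
    cancel : ∀ x y z → (x -ᶻ y) +ᶻ (y -ᶻ z) ≡ x -ᶻ z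
    cancel = solve-∀

  -- The induction step of the finite triple product for the coefficients κ, κ′ of consecutive sizes.
  pascal-sum : ∀ M s f (κ κ′ : ℕ → ℕ → Seq → Seq) →
               (∀ j i → Linear (κ j i)) → (∀ j i → Linear (κ′ j i)) →
               (∀ j i g → κ j (suc i) g ≗ κ′ j i g) →
               (∀ j i g → j + i ≡ M → κ (suc j) i (sh (i * m) g) ≗ neg (κ′ j i (sh s g))) →
               let X = antiSum (suc M) (λ j i → κ j i (C i j f)) in
               X ⊖ sh (row m M) X ≗ antiSum M (λ j i → κ′ j i (C i j (f ⊖ sh s f)))
  pascal-sum M s f κ κ′ κ-lin κ′-lin κᵢ κⱼ n = begin
    X n -ᶻ sh (row m M) X n
      ≡⟨ cong (λ z → X n -ᶻ z) (antiSum-linear (sh-linear (row m M)) (suc M) t n) ⟩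
    X n -ᶻ antiSum (suc M) (λ j i → sh (row m M) (t j i)) n
      ≡⟨ cong (X n +ᶻ_) (antiSum-linear neg-linear (suc M) (λ j i → sh (row m M) (t j i)) n) ⟩
    X n +ᶻ antiSum (suc M) (λ j i → neg (sh (row m M) (t j i))) n
      ≡⟨ antiSum-⊕ (suc M) t (λ j i → neg (sh (row m M) (t j i))) n ⟨
    antiSum (suc M) (λ j i → t j i ⊖ sh (row m M) (t j i)) n
      ≡⟨ antiSum-local (suc M) {λ j i → t j i ⊖ sh (row m M) (t j i)} {λ j i → tᵢ j i ⊕ tⱼ j i} t-pascal ⟩
    antiSum (suc M) (λ j i → tᵢ j i ⊕ tⱼ j i) n
      ≡⟨ antiSum-⊕ (suc M) tᵢ tⱼ n ⟩
    antiSum (suc M) tᵢ n +ᶻ antiSum (suc M) tⱼ n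
      ≡⟨ cong₂ _+ᶻ_ first second ⟩
    antiSum M (λ j i → κ′ j i (C i j f)) n +ᶻ antiSum M (λ j i → neg (κ′ j i (sh s (C i j f)))) n
      ≡⟨ antiSum-⊕ M (λ j i → κ′ j i (C i j f)) _ n ⟨
    antiSum M (λ j i → κ′ j i (C i j f) ⊖ κ′ j i (sh s (C i j f))) n
      ≡⟨ antiSum-local M (λ j i _ → ≡.trans (sym (⟦⊖⟧ (κ′-lin j i) (C i j f) (sh s (C i j f)) n))
           (⟦cong⟧ (κ′-lin j i) (linear-⊖sh (C-linear i j) s f) n)) ⟩
    antiSum M (λ j i → κ′ j i (C i j (f ⊖ sh s f))) n ∎
    where
    open ≡-Reasoning
    t tᵢ tⱼ : ℕ → ℕ → Seq
    t  j i = κ j i (C i j f)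
    tᵢ j i = κ j i (Cᵢ i j f)
    tⱼ j i = κ j i (sh (i * m) (Cⱼ i j f))
    X = antiSum (suc M) t
    t-pascal : ∀ j i → j + i ≡ suc M → (t j i ⊖ sh (row m M) (t j i)) n ≡ (tᵢ j i ⊕ tⱼ j i) n
    t-pascal j i eq = begin
      t j i n -ᶻ sh (row m M) (t j i) n
        ≡⟨ linear-⊖sh (κ-lin j i) (row m M) (C i j f) n ⟩
      κ j i (C i j f ⊖ sh (row m M) (C i j f)) n
        ≡⟨ ⟦cong⟧ (κ-lin j i) (λ k → ≡.trans
             (cong (λ u → C i j f k -ᶻ sh (u * m) (C i j f) k) (sym (≡.trans (ℕ.+-comm i j) eq)))
             (pascal i j f k)) n ⟩
      κ j i (Cᵢ i j f ⊕ sh (i * m) (Cⱼ i j f)) n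
        ≡⟨ ⟦⊕⟧ (κ-lin j i) (Cᵢ i j f) (sh (i * m) (Cⱼ i j f)) n ⟩
      tᵢ j i n +ᶻ tⱼ j i n ∎
    first : antiSum (suc M) tᵢ n ≡ antiSum M (λ j i → κ′ j i (C i j f)) n
    first = begin
      antiSum (suc M) tᵢ n
        ≡⟨ antiSum-last M tᵢ n ⟩
      antiSum M (λ j i → κ j (suc i) (C i j f)) n +ᶻ κ (suc M) 0 0̂ n
        ≡⟨ cong₂ _+ᶻ_ (antiSum-local M (λ j i _ → κᵢ j i (C i j f) n)) (⟦0̂⟧ (κ-lin (suc M) 0) n) ⟩
      antiSum M (λ j i → κ′ j i (C i j f)) n +ᶻ 0ℤ
        ≡⟨ ℤ.+-identityʳ _ ⟩
      antiSum M (λ j i → κ′ j i (C i j f)) n ∎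
    second : antiSum (suc M) tⱼ n ≡ antiSum M (λ j i → neg (κ′ j i (sh s (C i j f)))) n
    second = begin
      κ 0 (suc M) (sh (suc M * m) 0̂) n +ᶻ antiSum M (λ j i → κ (suc j) i (sh (i * m) (C i j f))) n
        ≡⟨ cong₂ _+ᶻ_ (≡.trans (⟦cong⟧ (κ-lin 0 (suc M)) (sh-0̂ (suc M * m)) n) (⟦0̂⟧ (κ-lin 0 (suc M)) n))
                     (antiSum-local M (λ j i eq → κⱼ j i (C i j f) eq n)) ⟩
      0ℤ +ᶻ antiSum M (λ j i → neg (κ′ j i (sh s (C i j f)))) n
        ≡⟨ ℤ.+-identityˡ _ ⟩
      antiSum M (λ j i → neg (κ′ j i (sh s (C i j f)))) n ∎

  -- In closed form c k + m k (k - 1) / 2. For c = a and k = ν + 1 it is the total of the parts a,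
  -- ..., a + mν that M requires.
  w : ℕ → ℕ → ℕ
  w c zero    = 0
  w c (suc k) = w c k + row c k

  k≤w : ∀ c .{{_ : NonZero c}} k → k ≤ w c k
  k≤w c       zero    = z≤n
  k≤w (suc c) (suc k) = ℕ.≤-trans (s≤s (k≤w (suc c) k)) (ℕ.≤-trans (ℕ.≤-reflexive (ℕ.+-comm 1 _)) (ℕ.+-monoʳ-≤ (w (suc c) k) (s≤s z≤n)))

  n<row : ∀ c .{{_ : NonZero c}} {n K} → n ≤ K → n < row c K
  n<row (suc c) {n} {K} n≤K = s≤s (ℕ.≤-trans n≤K (ℕ.≤-trans (ℕ.m≤m*n K m) (ℕ.m≤n+m _ c)))

  rows-truncate : ∀ c .{{_ : NonZero c}} {n} f j → II (rows c (j + n)) f n ≡ II (rows c n) f n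
  rows-truncate c f zero    = refl
  rows-truncate c {n} f (suc j) = ≡.trans (I-< (row c (j + n)) _ (n<row c (ℕ.m≤n+m n j))) (rows-truncate c f j)

  -- The row with index K is larger than K, so factors with index N or more act trivially up to
  -- degree N. This replaces the passage to infinite products.
  rows-local : ∀ c .{{_ : NonZero c}} {f g K K′} N → N ≤ K → N ≤ K′ → (∀ n → n ≤ N → f n ≡ g n) →
               ∀ n → n ≤ N → II (rows c K) f n ≡ II (rows c K′) g n
  rows-local c {f} {g} {K} {K′} N N≤K N≤K′ f≡g n n≤N = begin
    II (rows c K) f n                   ≡⟨ II-local (rows c K) N f≡g n n≤N ⟩
    II (rows c K) g n                   ≡⟨ cong (λ u → II (rows c u) g n) (ℕ.m∸n+n≡m (ℕ.≤-trans n≤N N≤K)) ⟨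
    II (rows c (K ∸ n + n)) g n       ≡⟨ rows-truncate c g (K ∸ n) ⟩
    II (rows c n) g n                   ≡⟨ rows-truncate c g (K′ ∸ n) ⟨
    II (rows c (K′ ∸ n + n)) g n      ≡⟨ cong (λ u → II (rows c u) g n) (ℕ.m∸n+n≡m (ℕ.≤-trans n≤N N≤K′)) ⟩
    II (rows c K′) g n                  ∎
    where open ≡-Reasoning

  rows-injective : ∀ c .{{_ : NonZero c}} K N {f g} → (∀ n → n ≤ N → II (rows c K) f n ≡ II (rows c K) g n) →
                   ∀ n → n ≤ N → f n ≡ g n
  rows-injective c zero    N h = h
  rows-injective c (suc K) N h = rows-injective c K N (I-injective (row c K) {{row-nonZero c K}} N h)

  module _ (a b : ℕ) .{{_ : NonZero a}} .{{_ : NonZero b}} (a+b≡m : a + b ≡ m) where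

    -- The exponent m k(k-1)/2 + a k of the triple product at k = j - N.
    e : ℕ → ℕ → ℕ
    e j       zero    = w a j
    e zero    (suc N) = w b (suc N)
    e (suc j) (suc N) = e j N

    e-0 : ∀ N → e 0 N ≡ w b N
    e-0 zero    = refl
    e-0 (suc N) = refl

    -- The exponents at k and k + 1 differ by a + k m; for k = j - N the summand N m is moved to the
    -- left to stay in ℕ.
    e-sucˡ : ∀ j N → e (suc j) N + N * m ≡ e j N + row a j
    e-sucˡ j       zero    = ℕ.+-identityʳ _
    e-sucˡ zero    (suc N) = ≡.trans (cong₂ (λ x m′ → x + (m′ + N * m)) (e-0 N) (sym a+b≡m))
      (regroup (w b N) a b (N * m))
      where
      regroup : ∀ x a b y → x + (a + b + y) ≡ x + (b + y) + (a + 0)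
      regroup = solveℕ-∀
    e-sucˡ (suc j) (suc N) = ≡.trans (regroup₁ (e (suc j) N) m (N * m))
      (≡.trans (cong (m +_) (e-sucˡ j N)) (regroup₂ m (e j N) a (j * m)))
      where
      regroup₁ : ∀ x m y → x + (m + y) ≡ m + (x + y)
      regroup₁ = solveℕ-∀
      regroup₂ : ∀ m x a y → m + (x + (a + y)) ≡ x + (a + (m + y))
      regroup₂ = solveℕ-∀

    e-sucʳ : ∀ j N → e j (suc N) + j * m ≡ e j N + row b N
    e-sucʳ zero    N = ≡.trans (ℕ.+-identityʳ _) (cong (_+ row b N) (sym (e-0 N)))
    e-sucʳ (suc j) zero = ≡.trans (cong (λ m′ → w a j + (m′ + j * m)) (sym a+b≡m))
      (regroup (w a j) a b (j * m))
      where
      regroup : ∀ x a b y → x + (a + b + y) ≡ x + (a + y) + (b + 0)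
      regroup = solveℕ-∀
    e-sucʳ (suc j) (suc N) = ≡.trans (regroup₁ (e j (suc N)) m (j * m))
      (≡.trans (cong (m +_) (e-sucʳ j N)) (regroup₂ m (e j N) b (N * m)))
      where
      regroup₁ : ∀ x m y → x + (m + y) ≡ m + (x + y)
      regroup₁ = solveℕ-∀
      regroup₂ : ∀ m x a y → m + (x + (a + y)) ≡ x + (a + (m + y))
      regroup₂ = solveℕ-∀

    -- On the antidiagonal the Pascal weight `i * m` offsets the dependence on j: every term is
    -- shifted by `row a N`, the exponent in the next factor 1 - z q^N.
    e-sucˡ′ : ∀ {j i N N′} → j + i ≡ N + N′ → e (suc j) N′ + i * m ≡ e j N′ + row a N
    e-sucˡ′ {j} {i} {N} {N′} eq = ℕ.+-cancelʳ-≡ (N′ * m) _ _ (begin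
      e (suc j) N′ + i * m + N′ * m         ≡⟨ regroup₁ (e (suc j) N′) (i * m) (N′ * m) ⟩
      e (suc j) N′ + N′ * m + i * m         ≡⟨ cong (_+ i * m) (e-sucˡ j N′) ⟩
      e j N′ + row a j + i * m                ≡⟨ regroup₂ (e j N′) a j i m ⟩
      e j N′ + (a + (j + i) * m)            ≡⟨ cong (λ u → e j N′ + (a + u * m)) eq ⟩
      e j N′ + (a + (N + N′) * m)           ≡⟨ regroup₂ (e j N′) a N N′ m ⟨
      e j N′ + row a N + N′ * m               ∎)
      where
      open ≡-Reasoning
      regroup₁ : ∀ x y z → x + y + z ≡ x + z + y
      regroup₁ = solveℕ-∀
      regroup₂ : ∀ x a j i m → x + (a + j * m) + i * m ≡ x + (a + (j + i) * m)
      regroup₂ = solveℕ-∀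

    -- Together with `N≤e+j` this bounds |j - N| by the exponent, so degrees up to n only see |k| ≤
    -- n.
    j≤e+N : ∀ j N → j ≤ e j N + N
    j≤e+N j       zero    = ℕ.≤-trans (k≤w a j) (ℕ.m≤m+n _ 0)
    j≤e+N zero    (suc N) = z≤n
    j≤e+N (suc j) (suc N) = ℕ.≤-trans (s≤s (j≤e+N j N)) (ℕ.≤-reflexive (sym (ℕ.+-suc (e j N) N)))

    N≤e+j : ∀ j N → N ≤ e j N + j
    N≤e+j j       zero    = z≤n
    N≤e+j zero    (suc N) = ℕ.≤-trans (k≤w b (suc N)) (ℕ.m≤m+n _ 0)
    N≤e+j (suc j) (suc N) = ℕ.≤-trans (s≤s (N≤e+j j N)) (ℕ.≤-reflexive (sym (ℕ.+-suc (e j N) j)))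

    base : ℕ → ℕ → Seq
    base N N′ = II (rows a N) (II (rows b N′) (δ true))

    -- Multiplication by (-1)^k z^k q^(k(k-1)/2) at k = j - N; the sign uses j + N, which has the
    -- parity of k.
    κ : ℕ → ℕ → Seq → Seq
    κ N j f = sg (j + N) (sh (e j N) f)

    κ-linear : ∀ N j → Linear (κ N j)
    κ-linear N j = ∘-linear (sg-linear (j + N)) (sh-linear (e j N))

    κ-shift : ∀ {k l x y x′ y′} f → k ≡ suc l → x + y ≡ x′ + y′ →
              sg k (sh x (sh y f)) ≗ neg (sg l (sh x′ (sh y′ f)))
    κ-shift {l = l} {x} {y} {x′} {y′} f refl eq n = cong (λ z → -ᶻ sgn l z)
      (≡.trans (sh-sh x y f n) (≡.trans (cong (λ s → sh s f n) eq) (sym (sh-sh x′ y′ f n))))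

    tripleSum : ℕ → ℕ → Seq
    tripleSum N N′ = antiSum (N + N′) (λ j i → κ N′ j (C i j (base N N′)))

    -- With i = N - k, j = N′ + k and q, z standing for q^m, q^a, this reads
    -- Σ (-1)^k z^k q^(k(k-1)/2) / ((q)_i (q)_j (z)_N (q/z)_N′) = 1 / (q)_(N+N′).
    finite-triple-product : ∀ N N′ → tripleSum N N′ ≗ II (rows m (N + N′)) (δ true)
    finite-triple-product zero zero n = refl
    finite-triple-product (suc N) N′ = I-unique (row m K) {{row-nonZero m K}} _ X unfold
      where
      K = N + N′
      X = tripleSum (suc N) N′
      f = base (suc N) N′
      diff : X ⊖ sh (row m K) X ≗ II (rows m K) (δ true)
      diff n = begin
        X n -ᶻ sh (row m K) X n
          ≡⟨ pascal-sum K (row a N) f (λ j _ → κ N′ j) (λ j _ → κ N′ j) (λ j _ → κ-linear N′ j) (λ j _ → κ-linear N′ j)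
               (λ _ _ _ _ → refl)
               (λ j i g eq → κ-shift {suc j + N′} {j + N′} {e (suc j) N′} {i * m} {e j N′} g refl (e-sucˡ′ {j} {i} {N} {N′} eq)) n ⟩
        antiSum K (λ j i → κ N′ j (C i j (f ⊖ sh (row a N) f))) n
          -- The factor 1 - z q^N produced by the Pascal rule cancels the last factor of 1 /
          -- (z)_(N+1) in `f`.
          ≡⟨ antiSum-local K (λ j i _ → ⟦cong⟧ (∘-linear (κ-linear N′ j) (C-linear i j)) (I-⊖ (row a N) {{row-nonZero a N}} (base N N′)) n) ⟩
        tripleSum N N′ n
          ≡⟨ finite-triple-product N N′ n ⟩
        II (rows m K) (δ true) n ∎
        where open ≡-Reasoning
      unfold : X ≗ II (rows m K) (δ true) ⊕ sh (row m K) X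
      unfold = ⊖⇒⊕ X (sh (row m K) X) diff
    finite-triple-product zero (suc N′) = I-unique (row m N′) {{row-nonZero m N′}} _ X unfold
      where
      X = tripleSum zero (suc N′)
      f = base zero (suc N′)
      -- When N′ grows, the Pascal weight has to fall on the other index, so the sum is reversed and
      -- i and j exchange roles.
      flipped : ∀ N → tripleSum zero N ≗ antiSum N (λ j i → κ N i (C i j (base zero N)))
      flipped N n = ≡.trans (antiSum-flip N (λ j i → κ N j (C i j (base zero N))) n)
        (antiSum-local N (λ j i _ → ⟦cong⟧ (κ-linear N i) (C-comm j i (base zero N)) n))
      Y = antiSum (suc N′) (λ j i → κ (suc N′) i (C i j f))
      diff : X ⊖ sh (row m N′) X ≗ II (rows m N′) (δ true)
      diff n = begin
        X n -ᶻ sh (row m N′) X n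
          ≡⟨ cong₂ _-ᶻ_ (flipped (suc N′) n) (sh-cong (row m N′) (flipped (suc N′)) n) ⟩
        Y n -ᶻ sh (row m N′) Y n
          ≡⟨ pascal-sum N′ (row b N′) f (λ _ i → κ (suc N′) i) (λ _ i → κ N′ i) (λ _ i → κ-linear (suc N′) i) (λ _ i → κ-linear N′ i)
               (λ j i g k → ≡.trans (cong (λ u → -ᶻ sgn u (sh (e i N′) g k)) (ℕ.+-suc i N′)) (ℤ.neg-involutive _))
               (λ j i g _ → κ-shift {i + suc N′} {i + N′} {e i (suc N′)} {i * m} {e i N′} g (ℕ.+-suc i N′) (e-sucʳ i N′)) n ⟩
        antiSum N′ (λ j i → κ N′ i (C i j (f ⊖ sh (row b N′) f))) n
          ≡⟨ antiSum-local N′ (λ j i _ → ⟦cong⟧ (∘-linear (κ-linear N′ i) (C-linear i j)) (I-⊖ (row b N′) {{row-nonZero b N′}} (base zero N′)) n) ⟩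
        antiSum N′ (λ j i → κ N′ i (C i j (base zero N′))) n
          ≡⟨ flipped N′ n ⟨
        tripleSum zero N′ n
          ≡⟨ finite-triple-product zero N′ n ⟩
        II (rows m N′) (δ true) n ∎
        where open ≡-Reasoning
      unfold : X ≗ II (rows m N′) (δ true) ⊕ sh (row m N′) X
      unfold = ⊖⇒⊕ X (sh (row m N′) X) diff

    -- The Jacobi triple product up to degree n

    sg-comm : ∀ {Φ} → Linear Φ → ∀ k f → Φ (sg k f) ≗ sg k (Φ f)
    sg-comm φ zero    f n = refl
    sg-comm φ (suc k) f n = ≡.trans (⟦neg⟧ φ (sg k f) n) (cong -ᶻ_ (sg-comm φ k f n))

    κ-comm : ∀ {Φ} → Linear Φ → ∀ N j f → Φ (κ N j f) ≗ κ N j (Φ f)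
    κ-comm φ N j f n = ≡.trans (sg-comm φ (j + N) (sh (e j N) f) n) (cong (sgn (j + N)) (⟦sh⟧ φ (e j N) f n))

    -- The series F of the overview with each product cut after n factors, correct up to degree n.
    F : ℕ → Seq
    F n = II (rows m n) (base n n)

    base-local : ∀ {n K K′} → n ≤ K → n ≤ K′ → ∀ x → x ≤ n → base K K x ≡ base K′ K′ x
    base-local {n} n≤K n≤K′ = rows-local a n n≤K n≤K′ (rows-local b n n≤K n≤K′ (λ _ _ → refl))

    C-local : ∀ {n i j K} → n ≤ i → n ≤ j → n ≤ K → ∀ x → x ≤ n → C i j (base K K) x ≡ C n n (base n n) x
    C-local {n} n≤i n≤j n≤K = rows-local m n n≤i ℕ.≤-refl (rows-local m n n≤j ℕ.≤-refl (base-local n≤K ℕ.≤-refl))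

    -- Dividing both sides by (q)_n gives the finite triple product up to degree n, where each term
    -- carries two such factors and `F n` supplies only one. Injectivity then removes the extra
    -- factor.
    triple-product : ∀ n → let J = n + n in ∀ x → x ≤ n → antiSum (J + J) (λ j _ → κ J j (F n)) x ≡ δ true x
    triple-product n = rows-injective m n n λ x x≤n → begin
      II (rows m n) (antiSum (J + J) (λ j _ → κ J j (F n))) x
        ≡⟨ antiSum-linear (II-linear (rows m n)) (J + J) (λ j _ → κ J j (F n)) x ⟩
      antiSum (J + J) (λ j _ → II (rows m n) (κ J j (F n))) x
        ≡⟨ antiSum-local (J + J) {λ j _ → II (rows m n) (κ J j (F n))} {λ j i → κ J j (C i j (base J J))}
             (λ j i eq → ≡.trans (κ-comm (II-linear (rows m n)) J j (F n) x) (cong (sgn (j + J)) (sym (term j i eq x x≤n)))) ⟩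
      tripleSum J J x
        ≡⟨ finite-triple-product J J x ⟩
      II (rows m (J + J)) (δ true) x
        ≡⟨ rows-local m n (ℕ.≤-trans n≤J (ℕ.m≤m+n J J)) ℕ.≤-refl (λ _ _ → refl) x x≤n ⟩
      II (rows m n) (δ true) x ∎
      where
      open ≡-Reasoning
      J = n + n
      n≤J : n ≤ J
      n≤J = ℕ.m≤m+n n n
      -- A term with e j J ≤ n has |j - J| ≤ n = J - n, so that i and j are at least n.
      term : ∀ j i → j + i ≡ J + J → ∀ x → x ≤ n →
             sh (e j J) (C i j (base J J)) x ≡ sh (e j J) (C n n (base n n)) x
      term j i eq x x≤n with e j J ℕ.≤? n
      ... | no  e≰n = ≡.trans (sh-< (e j J) _ x<e) (sym (sh-< (e j J) _ x<e))
        where x<e = ℕ.≤-<-trans x≤n (ℕ.≰⇒> e≰n)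
      ... | yes e≤n = sh-local (e j J) x (λ k k≤x → C-local n≤i n≤j n≤J k (ℕ.≤-trans k≤x x≤n))
        where
        n≤j : n ≤ j
        n≤j = ℕ.+-cancelˡ-≤ n n j (ℕ.≤-trans (N≤e+j j J) (ℕ.+-monoˡ-≤ j e≤n))
        n≤i : n ≤ i
        n≤i = ℕ.+-cancelˡ-≤ (n + J) n i (ℕ.≤-trans (ℕ.≤-reflexive (≡.trans (ℕ.+-comm (n + J) n) (≡.trans (sym (ℕ.+-assoc n n J)) (sym eq))))
          (ℕ.+-monoˡ-≤ i (ℕ.≤-trans (j≤e+N j J) (ℕ.+-monoˡ-≤ J e≤n))))

    -- The central term j = N′, that is k = 0, is f; larger j give the exponents `w a`, smaller j
    -- give `w b`. Recursion on N′ peels off the most negative k.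
    antiSum-two-sided : ∀ N N′ f n → antiSum (N′ + N) (λ j _ → κ N′ j f) n ≡
                  f n -ᶻ alt N (λ k → sh (w a (suc k)) f n) -ᶻ alt N′ (λ k → sh (w b (suc k)) f n)
    antiSum-two-sided N zero f n = begin
      antiSum N (λ j _ → κ 0 j f) n
        ≡⟨ antiSum-local N {λ j _ → κ 0 j f} {λ j _ → sg j (sh (w a j) f)}
             (λ j _ _ → cong (λ u → sgn u (sh (w a j) f n)) (ℕ.+-identityʳ j)) ⟩
      antiSum N (λ j _ → sg j (sh (w a j) f)) n
        ≡⟨ antiSum-alt N (λ j → sh (w a j) f) n ⟩
      f n -ᶻ alt N (λ k → sh (w a (suc k)) f n)
        ≡⟨ ℤ.+-identityʳ _ ⟨
      f n -ᶻ alt N (λ k → sh (w a (suc k)) f n) -ᶻ 0ℤ ∎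
      where open ≡-Reasoning
    antiSum-two-sided N (suc N′) f n = begin
      -ᶻ sgn N′ (hb N′) +ᶻ antiSum (N′ + N) (λ j _ → κ (suc N′) (suc j) f) n
        ≡⟨ cong (-ᶻ sgn N′ (hb N′) +ᶻ_) (antiSum-local (N′ + N) {λ j _ → κ (suc N′) (suc j) f} {λ j _ → κ N′ j f} (λ j _ _ →
             ≡.trans (cong (λ u → -ᶻ sgn u (sh (e j N′) f n)) (ℕ.+-suc j N′)) (ℤ.neg-involutive _))) ⟩
      -ᶻ sgn N′ (hb N′) +ᶻ antiSum (N′ + N) (λ j _ → κ N′ j f) n
        ≡⟨ cong (-ᶻ sgn N′ (hb N′) +ᶻ_) (antiSum-two-sided N N′ f n) ⟩
      -ᶻ sgn N′ (hb N′) +ᶻ (f n -ᶻ A -ᶻ alt N′ hb)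
        ≡⟨ regroup (sgn N′ (hb N′)) (f n -ᶻ A) (alt N′ hb) ⟩
      f n -ᶻ A -ᶻ (alt N′ hb +ᶻ sgn N′ (hb N′))
        ≡⟨ cong (λ z → f n -ᶻ A -ᶻ z) (alt-last N′ hb) ⟨
      f n -ᶻ A -ᶻ alt (suc N′) hb ∎
      where
      open ≡-Reasoning
      A = alt N (λ k → sh (w a (suc k)) f n)
      hb = λ k → sh (w b (suc k)) f n
      regroup : ∀ x y z → -ᶻ x +ᶻ (y -ᶻ z) ≡ y -ᶻ (z +ᶻ x)
      regroup = solve-∀

    F-alternating : ∀ n → 1 ≤ n → let J = n + n in
                    F n n ≡ alt J (λ k → sh (w a (suc k)) (F n) n) +ᶻ alt J (λ k → sh (w b (suc k)) (F n) n)
    -- For positive n the coefficient `δ true n` reduces to 0.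
    F-alternating n@(suc _) _ = solve-for (≡.trans (sym (antiSum-two-sided J J (F n) n)) (triple-product n n ℕ.≤-refl))
      where
      J = n + n
      restore : ∀ x y z → x ≡ (x -ᶻ y -ᶻ z) +ᶻ (y +ᶻ z)
      restore = solve-∀
      solve-for : ∀ {x y z} → x -ᶻ y -ᶻ z ≡ 0ℤ → x ≡ y +ᶻ z
      solve-for {x} {y} {z} eq = ≡.trans (restore x y z) (≡.trans (cong (_+ᶻ (y +ᶻ z)) eq) (ℤ.+-identityˡ _))

  -- Assembly of the residue classes

  others : ℕ → ℕ → List ℕ
  others c zero    = []
  others c (suc T) = row m T ∷ row c T ∷ others c T

  II-others : ∀ c T f → II (others c T) f ≗ II (rows m T) (II (rows c T) f)
  II-others c zero    f n = refl
  II-others c (suc T) f = ⟦cong⟧ (I-linear (row m T)) λ k →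
    ≡.trans (⟦cong⟧ (I-linear (row c T)) (II-others c T f) k) (sym (II-I (rows m T) (row c T) (II (rows c T) f) k))

  module Counting (a b : ℕ) .{{_ : NonZero a}} .{{_ : NonZero b}} (a+b≡m : a + b ≡ m) (ok : ℕ → Bool)
                  (split : ∀ T → Split ok (λ x → x ≡ a mod m) (down (T * m)) (rows a T) (others b T)) where
    open Class a

    cls : ℕ → Bool
    cls x = x ≡ a mod m

    Φ : ℕ → Seq → Seq
    Φ T f = II (rows m T) (II (rows b T) f)

    Φ-linear : ∀ T → Linear (Φ T)
    Φ-linear T = ∘-linear (II-linear (rows m T)) (II-linear (rows b T))

    Φ-c : ∀ {n T K} → n ≤ T → n ≤ K → ∀ x → x ≤ n → Φ T (c K) x ≡ F a b a+b≡m n x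
    Φ-c {n} {T} {K} n≤T n≤K x x≤n = ≡.trans
      (rows-local m n n≤T ℕ.≤-refl (rows-local b n n≤T ℕ.≤-refl (rows-local a n n≤K ℕ.≤-refl (λ _ _ → refl))) x x≤n)
      (⟦cong⟧ (II-linear (rows m n)) (II-comm (rows b n) (rows a n) (δ true)) x)

    count-onCls : ∀ P n T → n ≤ T → pos (countPartitions (onCls ok cls P) n) ≡ Φ T (E (rows a T) P) n
    count-onCls P n T n≤T = ≡.trans (countPartitions-E (onCls ok cls P) (ℕ.≤-trans n≤T (ℕ.m≤m*n T m)))
      (≡.trans (E-split ok cls (split T) P n) (II-others b T (E (rows a T) P) n))

    count-all : ∀ n → pos (countPartitions (onCls ok cls (const true)) n) ≡ F a b a+b≡m n n
    count-all n = ≡.trans (count-onCls (const true) n n ℕ.≤-refl)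
      (≡.trans (⟦cong⟧ (Φ-linear n) (E-true (rows a n)) n) (Φ-c ℕ.≤-refl ℕ.≤-refl n ℕ.≤-refl))

    -- Here `g j` plays the role of G_j with the other parts restored: `w a (suc j)` accounts for
    -- the required parts and `V n j` for the rest. `V-step` relates consecutive j, and the
    -- telescoping ends at J because `w a (suc J)` exceeds n.
    count-MProp : ∀ n J → n ≤ J → pos (countPartitions (onCls ok cls (MProp a m 0)) n) ≡
                  alt J (λ k → sh (w a (suc k)) (F a b a+b≡m n) n)
    count-MProp n J n≤J = ≡.trans initial (alt-telescope J g _ step vanish)
      where
      -- `E-MProp` with D = n and an empty prefix starts from rows of at most n + 2 boxes.
      N = suc (suc n)
      n≤N : n ≤ N
      n≤N = ℕ.m≤n+m n 2
      g : ℕ → ℤ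
      g j = Φ N (sh (w a (suc j)) (V n j)) n
      initial : pos (countPartitions (onCls ok cls (MProp a m 0)) n) ≡ g 0
      initial = ≡.trans (count-onCls (MProp a m 0) n N n≤N) (⟦cong⟧ (Φ-linear N) (λ k → begin
        E (rows a N) (MProp a m 0) k
          ≡⟨ cong (λ u → E (rows a (suc (suc u))) (MProp a m 0) k) (sym (ℕ.+-identityʳ n)) ⟩
        E (rows a (suc (suc (n + 0)))) (MProp a m 0) k
          ≡⟨ E-MProp n [] [] [] k ⟩
        sh a (V n 0) k
          ≡⟨ cong (λ s → sh s (V n 0) k) (sym (ℕ.+-identityʳ a)) ⟩
        sh (w a 1) (V n 0) k ∎) n)
        where open ≡-Reasoning
      step : ∀ j → g j ≡ sh (w a (suc j)) (F a b a+b≡m n) n -ᶻ g (suc j)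
      step j = begin
        Φ N (sh u (V n j)) n
          ≡⟨ ⟦cong⟧ (Φ-linear N) (sh-cong u V≗) n ⟩
        Φ N (sh u (c K ⊖ sh (row a (suc j)) (V n (suc j)))) n
          ≡⟨ ⟦⊖⟧ (∘-linear (Φ-linear N) (sh-linear u)) (c K) (sh (row a (suc j)) (V n (suc j))) n ⟩
        Φ N (sh u (c K)) n -ᶻ Φ N (sh u (sh (row a (suc j)) (V n (suc j)))) n
          ≡⟨ cong₂ _-ᶻ_ (≡.trans (⟦sh⟧ (Φ-linear N) u (c K) n)
                         (sh-local u n (Φ-c n≤N (ℕ.≤-trans (ℕ.m≤m+n n j) (ℕ.m≤n+m (n + j) 2)))))
                       (⟦cong⟧ (Φ-linear N) (sh-sh u (row a (suc j)) (V n (suc j))) n) ⟩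
        sh u (F a b a+b≡m n) n -ᶻ g (suc j) ∎
        where
        open ≡-Reasoning
        u = w a (suc j)
        K = suc (suc (n + j))
        restore : ∀ x y → x ≡ (x +ᶻ y) -ᶻ y
        restore = solve-∀
        V≗ : V n j ≗ c K ⊖ sh (row a (suc j)) (V n (suc j))
        V≗ k = ≡.trans (restore (V n j k) _) (cong (_-ᶻ sh (row a (suc j)) (V n (suc j)) k) (V-step n j k))
      vanish : g J ≡ 0ℤ
      vanish = ≡.trans (⟦sh⟧ (Φ-linear N) (w a (suc J)) (V n J) n)
        (sh-< (w a (suc J)) (Φ N (V n J)) (ℕ.<-≤-trans (s≤s n≤J) (k≤w a (suc J))))

  count-decomposition : ∀ a b .{{_ : NonZero a}} .{{_ : NonZero b}} → a + b ≡ m → ∀ ok →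
    (∀ T → Split ok (λ x → x ≡ a mod m) (down (T * m)) (rows a T) (others b T)) →
    (∀ T → Split ok (λ x → x ≡ b mod m) (down (T * m)) (rows b T) (others a T)) →
    ∀ n → 1 ≤ n →
    countPartitions (onCls ok (λ x → x ≡ a mod m) (const true)) n ≡
      countPartitions (onCls ok (λ x → x ≡ a mod m) (MProp a m 0)) n +
      countPartitions (onCls ok (λ x → x ≡ b mod m) (MProp b m 0)) n
  count-decomposition a b a+b≡m ok splitA splitB n 1≤n = ℤ.+-injective (begin
    pos (countPartitions (onCls ok A.cls (const true)) n)
      ≡⟨ A.count-all n ⟩
    F a b a+b≡m n n
      ≡⟨ F-alternating a b a+b≡m n 1≤n ⟩
    alt J (λ k → sh (w a (suc k)) (F a b a+b≡m n) n) +ᶻ alt J (λ k → sh (w b (suc k)) (F a b a+b≡m n) n)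
      ≡⟨ cong₂ _+ᶻ_ (sym (A.count-MProp n J n≤J))
           (≡.trans (alt-cong J (λ k → sh-cong (w b (suc k)) F-sym n)) (sym (B.count-MProp n J n≤J))) ⟩
    pos (countPartitions (onCls ok A.cls (MProp a m 0)) n) +ᶻ pos (countPartitions (onCls ok B.cls (MProp b m 0)) n) ∎)
    where
    open ≡-Reasoning
    b+a≡m = ≡.trans (ℕ.+-comm b a) a+b≡m
    module A = Counting a b a+b≡m ok splitA
    module B = Counting b a b+a≡m ok splitB
    J = n + n
    n≤J = ℕ.m≤m+n n n
    F-sym : F a b a+b≡m n ≗ F b a b+a≡m n
    F-sym = ⟦cong⟧ (II-linear (rows m n)) (II-comm (rows a n) (rows b n) (δ true))

-- The moduli 3 and 4

countPartitions-cong : ∀ {P Q} → P ≗ Q → ∀ n → countPartitions P n ≡ countPartitions Q n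
countPartitions-cong {P} {Q} P≗Q n = ℤ.+-injective (≡.trans (countPartitions-E P {n} {n} ℕ.≤-refl)
  (≡.trans (E-cong-≗ (down n) P≗Q n) (sym (countPartitions-E Q {n} {n} ℕ.≤-refl))))

module _ where
  open Rows 3
  open Triple 3

  private
    anyPart : ℕ → Bool
    anyPart _ = true

    -- In every use x and y are numerals, so the right-hand side evaluates to the Boolean that
    -- `Split` asks for.
    mod3 : ∀ x y T → ((x + T * 3) ≡ y mod 3) ≡ (x ≡ y mod 3)
    mod3 x y T = cong (_≡ᵇ y % 3) ([m+kn]%n≡m%n x T 3)

    split₂ : ∀ T → Split anyPart (λ x → x ≡ 2 mod 3) (down (T * 3)) (rows 2 T) (others 1 T)
    split₂ zero    = []
    split₂ (suc T) = other refl (mod3 3 2 T) (inCls refl (mod3 2 2 T) (other refl (mod3 1 2 T) (split₂ T)))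

    split₁ : ∀ T → Split anyPart (λ x → x ≡ 1 mod 3) (down (T * 3)) (rows 1 T) (others 2 T)
    split₁ zero    = []
    split₁ (suc T) = other refl (mod3 3 1 T) (other refl (mod3 2 1 T) (inCls refl (mod3 1 1 T) (split₁ T)))

    onCls-anyPart : ∀ cls P l → onCls anyPart cls P l ≡ P (filter (λ x → T? (cls x)) l)
    onCls-anyPart cls P l = cong (_∧ P (filter (λ x → T? (cls x)) l)) (all-true (All.universal (λ _ → refl) l))

  p-decomposition : ∀ n → 1 ≤ n → p n ≡ pGen 2 3 0 n + pGen 1 3 0 n
  p-decomposition n 1≤n = begin
    p n
      ≡⟨ countPartitions-cong (onCls-anyPart (λ x → x ≡ 2 mod 3) (const true)) n ⟨
    countPartitions (onCls anyPart (λ x → x ≡ 2 mod 3) (const true)) n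
      ≡⟨ count-decomposition 2 1 refl anyPart split₂ split₁ n 1≤n ⟩
    countPartitions (onCls anyPart (λ x → x ≡ 2 mod 3) (MProp 2 3 0)) n +
    countPartitions (onCls anyPart (λ x → x ≡ 1 mod 3) (MProp 1 3 0)) n
      ≡⟨ cong₂ _+_ (countPartitions-cong (onCls-anyPart (λ x → x ≡ 2 mod 3) (MProp 2 3 0)) n)
                     (countPartitions-cong (onCls-anyPart (λ x → x ≡ 1 mod 3) (MProp 1 3 0)) n) ⟩
    pGen 2 3 0 n + pGen 1 3 0 n ∎
    where open ≡-Reasoning

module _ where
  open Rows 4
  open Triple 4

  private
    not2mod4 : ℕ → Bool
    not2mod4 x = not (x ≡ 2 mod 4)

    mod4 : ∀ x y T → ((x + T * 4) ≡ y mod 4) ≡ (x ≡ y mod 4)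
    mod4 x y T = cong (_≡ᵇ y % 4) ([m+kn]%n≡m%n x T 4)

    ok4 : ∀ x T → not2mod4 (x + T * 4) ≡ not2mod4 x
    ok4 x T = cong not (mod4 x 2 T)

    split₃ : ∀ T → Split not2mod4 (λ x → x ≡ 3 mod 4) (down (T * 4)) (rows 3 T) (others 1 T)
    split₃ zero    = []
    split₃ (suc T) = other (ok4 4 T) (mod4 4 3 T) (inCls (ok4 3 T) (mod4 3 3 T)
      (notOk (ok4 2 T) (other (ok4 1 T) (mod4 1 3 T) (split₃ T))))

    split₁ : ∀ T → Split not2mod4 (λ x → x ≡ 1 mod 4) (down (T * 4)) (rows 1 T) (others 3 T)
    split₁ zero    = []
    split₁ (suc T) = other (ok4 4 T) (mod4 4 1 T) (other (ok4 3 T) (mod4 3 1 T)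
      (notOk (ok4 2 T) (inCls (ok4 1 T) (mod4 1 1 T) (split₁ T))))

  p24-decomposition : ∀ n → 1 ≤ n → p24 n ≡ p24Gen 3 0 n + p24Gen 1 0 n
  p24-decomposition n 1≤n = ≡.trans
    -- Only the trailing `∧ true` of `onCls` has to be inserted; both `p24Gen` counts are instances
    -- of `onCls` by definition.
    (countPartitions-cong (λ l → sym (∧-identityʳ (no2mod4 l))) n)
    (count-decomposition 3 1 refl not2mod4 split₃ split₁ n 1≤n)

theorem1p9 : (n : ℕ) → n ≥ 1 →
    (p n ≡ pGen 2 3 0 n + pGen 1 3 0 n)
    × (p24 n ≡ p24Gen 3 0 n + p24Gen 1 0 n)
theorem1p9 n n≥1 = p-decomposition n n≥1 , p24-decomposition n n≥1
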